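{- Let $\alpha$ and $\beta$ be fixed partitions and $n,m$ fixed nonnegative integers. Then $$(-1)^{v(\alpha)+v(\beta)}\sum_{\substack{\lambda:\ \lambda/\alpha\vdash m\\ \lambda/\beta\vdash n}}(-1)^{v(\lambda)}I_{\lambda/\alpha}I_{\lambda/\beta}=(-1)^{mn}\sum_{\substack{\mu:\ \beta/\mu\vdash m\\ \alpha/\mu\vdash n}}(-1)^{v(\mu)}I_{\beta/\mu}I_{\alpha/\mu}+\frac{1-(-1)^{mn}}{2}\sum_{\substack{\mu:\ \beta/\mu\vdash m-1\\ \alpha/\mu\vdash n-1}}(-1)^{v(\mu)}I_{\beta/\mu}I_{\alpha/\mu}.$$
   Context: Partitions are identified with Young diagrams (cell $(i,j)$: row $i$, column $j$); for $\mu\subseteq\lambda$, $\lambda/\mu$ is the set of cells of $\lambda$ not in $\mu$ and $\lambda/\mu\vdash n$ means $\mu\subseteq\lambda$ and it has $n$ cells. $v(\lambda)$ is the number of cells of $\lambda$ in even-numbered rows. A standard Young tableau (SYT) of shape $\lambda/\mu\vdash n$ is a bijection $T$ from its cells to $[n]$ with $T(i,j)\le T(i',j')$ whenever $i\le i'$, $j\le j'$. Write $(i,j)\lhd(i',j')$ if $i<i'$ or ($i=i'$, $j<j'$). For $T$ of straight shape, ${\rm sign}(T)=(-1)^{\#\{(a,b):a\lhd b,\,T(a)>T(b)\}}$. For $T_1$ of shape $\nu/\mu\vdash k$ and $T_2$ of shape $\lambda/\nu$, $T_1\diamond T_2$ equals $T_1$ on $\nu/\mu$ and $T_2+k$ on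 $\lambda/\nu$. For $T$ of shape $\lambda/\mu$, ${\rm sign}(T)={\rm sign}(T_0){\rm sign}(T_0\diamond T)$ for any SYT $T_0$ of shape $\mu$ (independent of $T_0$), and $I_{\lambda/\mu}=\sum_T{\rm sign}(T)$ over SYTs of shape $\lambda/\mu$. -}

module Defs where

open import Data.Nat as ℕ using (ℕ; zero; suc; _≤_; _≤ᵇ_; _<ᵇ_; _≡ᵇ_)
open import Data.Nat.Properties using (_≤?_)
open import Data.Bool using (Bool; true; false; _∧_; _∨_; not; if_then_else_)
open import Data.Integer as ℤ using (ℤ; +_)
open import Data.List using (List; []; _∷_; _++_; map; concatMap; filter; length; upTo; foldr)
open import Data.Nat.ListAction using (sum)
open import Data.List.Relation.Unary.All using (All)
open import Data.List.Relation.Unary.All.Properties using ()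
open import Data.List.Relation.Unary.Linked using (Linked)
open import Data.Product using (_×_; _,_; proj₁; proj₂)
open import Data.Unit using (⊤)
open import Data.Empty using (⊥)

IsPartition : List ℕ → Set
IsPartition λs = All (λ x → 1 ≤ x) λs × Linked (λ a b → b ≤ a) λs

decreasingᵇ : List ℕ → Bool
decreasingᵇ [] = true
decreasingᵇ (x ∷ []) = true
decreasingᵇ (x ∷ y ∷ ys) = (y ≤ᵇ x) ∧ decreasingᵇ (y ∷ ys)

positiveᵇ : List ℕ → Bool
positiveᵇ [] = true
positiveᵇ (x ∷ xs) = (1 ≤ᵇ x) ∧ positiveᵇ xs

isPartitionᵇ : List ℕ → Bool
isPartitionᵇ λs = positiveᵇ λs ∧ decreasingᵇ λs

size : List ℕ → ℕ
size = sum

part : List ℕ → ℕ → ℕ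
part [] _ = 0
part (x ∷ xs) zero = x
part (x ∷ xs) (suc i) = part xs i

-- v(λ): number of cells in even-numbered rows (rows numbered from 1),
-- i.e. λ₂ + λ₄ + …
v : List ℕ → ℕ
v [] = 0
v (x ∷ []) = 0
v (x ∷ y ∷ ys) = y ℕ.+ v ys

containedᵇ : List ℕ → List ℕ → Bool
containedᵇ [] _ = true
containedᵇ (x ∷ xs) [] = false
containedᵇ (x ∷ xs) (y ∷ ys) = (x ≤ᵇ y) ∧ containedᵇ xs ys

-- Cells. A cell is (row, column), both 0-based here (the parity of rows
-- only enters through v, which is defined with 1-based rows above).

Cell : Set
Cell = ℕ × ℕ

rowCells : ℕ → ℕ → List Cell
rowCells i len = map (λ j → (i , j)) (upTo len)

cellsFrom : ℕ → List ℕ → List Cell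
cellsFrom i [] = []
cellsFrom i (x ∷ xs) = rowCells i x ++ cellsFrom (suc i) xs

cells : List ℕ → List Cell
cells = cellsFrom 0

inDiagramᵇ : List ℕ → Cell → Bool
inDiagramᵇ μ (i , j) = j <ᵇ part μ i

skewCells : List ℕ → List ℕ → List Cell
skewCells λs μ = filter (λ c → Data.Bool.T? (not (inDiagramᵇ μ c))) (cells λs)
  where import Data.Bool

Filling : Set
Filling = List (Cell × ℕ)

◁ᵇ : Cell → Cell → Bool
◁ᵇ (i , j) (i' , j') = (i <ᵇ i') ∨ ((i ≡ᵇ i') ∧ (j <ᵇ j'))

≤cᵇ : Cell → Cell → Bool
≤cᵇ (i , j) (i' , j') = (i ≤ᵇ i') ∧ (j ≤ᵇ j')

allᵇ : {A : Set} → (A → Bool) → List A → Bool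
allᵇ p [] = true
allᵇ p (x ∷ xs) = p x ∧ allᵇ p xs

countᵇ : {A : Set} → (A → Bool) → List A → ℕ
countᵇ p [] = 0
countᵇ p (x ∷ xs) = (if p x then 1 else 0) ℕ.+ countᵇ p xs

pairs : {A : Set} → List A → List (A × A)
pairs xs = concatMap (λ a → map (λ b → (a , b)) xs) xs

monotoneᵇ : Filling → Bool
monotoneᵇ T = allᵇ (λ { ((a , x) , (b , y)) → if ≤cᵇ a b then x ≤ᵇ y else true }) (pairs T)

neg1^ : ℕ → ℤ
neg1^ zero = + 1
neg1^ (suc k) = ℤ.- neg1^ k

inversions : Filling → ℕ
inversions T = countᵇ (λ { ((a , x) , (b , y)) → ◁ᵇ a b ∧ (y <ᵇ x) }) (pairs T)

signStraight : Filling → ℤ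
signStraight T = neg1^ (inversions T)

-- Standard Young tableaux of shape λ/μ ⊢ n, enumerated as: for each
-- permutation (w₁,…,wₙ) of (1,…,n), put wₖ in the k-th cell of λ/μ
-- (cells listed in ◁ order); keep those fillings that are monotone.
-- These are exactly the bijections λ/μ → [n] that are order preserving.

insertions : ℕ → List ℕ → List (List ℕ)
insertions x [] = (x ∷ []) ∷ []
insertions x (y ∷ ys) = (x ∷ y ∷ ys) ∷ map (y ∷_) (insertions x ys)

perms : List ℕ → List (List ℕ)
perms [] = [] ∷ []
perms (x ∷ xs) = concatMap (insertions x) (perms xs)

zipF : List Cell → List ℕ → Filling
zipF [] _ = []
zipF _ [] = []
zipF (c ∷ cs) (x ∷ xs) = (c , x) ∷ zipF cs xs

oneTo : ℕ → List ℕ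
oneTo n = map suc (upTo n)

fillingsOf : List Cell → List Filling
fillingsOf cs = map (zipF cs) (perms (oneTo (length cs)))

SYT : List ℕ → List ℕ → List Filling
SYT λs μ = filter (λ T → Data.Bool.T? (monotoneᵇ T)) (fillingsOf (skewCells λs μ))
  where import Data.Bool

_⋄_ : Filling → Filling → Filling
T₁ ⋄ T₂ = T₁ ++ map (λ { (c , x) → (c , x ℕ.+ length T₁) }) T₂

-- A fixed SYT T₀ of shape μ: the row reading tableau (1,…,|μ| along rows).
T₀ : List ℕ → Filling
T₀ μ = zipF (cells μ) (oneTo (length (cells μ)))

signSkew : List ℕ → Filling → ℤ
signSkew μ T = signStraight (T₀ μ) ℤ.* signStraight (T₀ μ ⋄ T)

sumℤ : List ℤ → ℤ
sumℤ = foldr ℤ._+_ (+ 0)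

I : List ℕ → List ℕ → ℤ
I λs μ = sumℤ (map (signSkew μ) (SYT λs μ))

-- Finite enumeration of partitions: every partition of size ≤ N has at
-- most N parts, each at most N; we enumerate all such lists and filter.

listsOfLength : ℕ → ℕ → List (List ℕ)
listsOfLength zero N = [] ∷ []
listsOfLength (suc k) N = concatMap (λ x → map (x ∷_) (listsOfLength k N)) (oneTo N)

partitionsUpTo : ℕ → List (List ℕ)
partitionsUpTo N =
  filter (λ l → Data.Bool.T? (isPartitionᵇ l ∧ (size l ℕ.≤ᵇ N)))
         (concatMap (λ k → listsOfLength k N) (upTo (suc N)))
  where import Data.Bool

skewSizeᵇ : List ℕ → List ℕ → ℕ → Bool
skewSizeᵇ λs α m = containedᵇ α λs ∧ (size λs ≡ᵇ size α ℕ.+ m)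

sumUp : List ℕ → List ℕ → ℕ → ℕ → ℤ
sumUp α β m n =
  sumℤ (map (λ l → neg1^ (v l) ℤ.* I l α ℤ.* I l β)
            (filter (λ l → Data.Bool.T? (skewSizeᵇ l α m ∧ skewSizeᵇ l β n))
                    (partitionsUpTo (size α ℕ.+ m))))
  where import Data.Bool

sumDown : List ℕ → List ℕ → ℕ → ℕ → ℤ
sumDown α β a b =
  sumℤ (map (λ μ → neg1^ (v μ) ℤ.* I β μ ℤ.* I α μ)
            (filter (λ μ → Data.Bool.T? (skewSizeᵇ β μ a ∧ skewSizeᵇ α μ b))
                    (partitionsUpTo (size β))))
  where import Data.Bool

{-# OPTIONS --safe #-}
module Submission where

-- Let U add a cell to a partition λ in all possible rows i, with sign (-1)^(λᵢ₊₁ + λᵢ₊₂ + …), and let D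
-- be the adjoint of U twisted by (-1)^v.  Removing the largest entry of a tableau shows that I_{λ/α} is
-- the coefficient of λ in U^m α, so the three sums are matrix coefficients of D^n U^m, U^m D^n and
-- U^(m-1) D^(n-1).  The signs make the lattice of partitions a signed differential poset, D U + U D = 1,
-- and the identity is the resulting normal ordering of D^n U^m.

open import Defs
open import Data.Nat using (ℕ; _*_; _+_; _∸_)
open import Data.Integer using (ℤ; +_; _-_) renaming (_*_ to _*ℤ_; _+_ to _+ℤ_)
open import Data.Integer.DivMod using (_/_)
open import Data.List using (List)
open import Relation.Binary.PropositionalEquality using (_≡_)

open import Algebra.Properties.CommutativeSemigroup using (interchange)
open import Data.Bool using (Bool; true; false; T; T?; _∧_; not; if_then_else_)
open import Data.Bool.Properties using (∧-identityʳ; ∧-zeroʳ)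
open import Data.Empty using (⊥-elim)
open import Data.Integer using (-_; -1ℤ; 0ℤ; 1ℤ)
open import Data.Integer.Properties
  using (*-zeroʳ; *-identityˡ; *-identityʳ; *-comm; *-assoc; neg-involutive; neg-distribˡ-*; -1*i≡-i)
  renaming (+-identityˡ to +ℤ-identityˡ; +-identityʳ to +ℤ-identityʳ; +-assoc to +ℤ-assoc)
open import Data.Integer.Tactic.RingSolver using (solve-∀)
open import Data.List using ([]; _∷_; [_]; map; _++_; concatMap; filter; length; upTo; drop)
open import Data.List.Properties
  using (map-++; map-upTo; upTo-∷ʳ; length-map; length-upTo; length-++; filter-++; ++-assoc; ++-identityʳ)
open import Data.List.Relation.Binary.Permutation.Propositional using (_↭_; refl; prep; swap)
  renaming (trans to ↭trans)
open import Data.List.Relation.Binary.Permutation.Propositional.Properties using (↭-length; All-resp-↭)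
open import Data.List.Relation.Unary.All as All using (All; []; _∷_)
import Data.List.Relation.Unary.All.Properties as Allₚ
open import Data.List.Relation.Unary.Linked using (_∷_)
open import Data.Nat using (zero; suc; pred; _≤_; _<_; z≤n; s≤s; _<ᵇ_; _≤ᵇ_; _≡ᵇ_)
open import Data.Nat.GeneralisedArithmetic using (fold)
open import Data.Nat.Properties as ℕₚ
  using ( ≤-refl; ≤-trans; ≤-antisym; ≤-reflexive; ≤-pred; <⇒≤; <⇒≱; <⇒≢; ≰⇒>; ≮⇒≥; n≤1+n; m≤n⇒m≤1+n; m≤m+n; m≤n+m; _≤?_
        ; <⇒<ᵇ; <ᵇ⇒<; ≤⇒≤ᵇ; ≤ᵇ⇒≤; ≡ᵇ⇒≡; ≡⇒≡ᵇ; suc-injective; +-suc; +-comm; +-identityʳ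
        ; +-cancelˡ-≡; +-cancelʳ-≡; +-cancelʳ-<; +-monoˡ-≤; +-monoˡ-<; +-mono-≤; +-mono-<-≤)
open import Data.Product using (_×_; _,_; proj₁; proj₂)
open import Data.Sum using (_⊎_; inj₁; inj₂)
open import Data.Unit using (⊤; tt)
open import Function using (_∘_; const)
open import Relation.Binary.PropositionalEquality using (refl; sym; trans; cong; cong₂; subst; module ≡-Reasoning)
open import Relation.Nullary using (¬_; yes; no)
open ≡-Reasoning

-- The signed differential poset of partitions

-- A formal sum of partitions is represented by its coefficient function, so `U` reads the shapes
-- with one corner removed and `D` those with one cell added. Both recurse on rows, because the sign
-- of a row depends only on the rows below it. Changing a row and then a lower one, or the reverse,
-- gives opposite signs, since the sign of the upper row counts the cells below: this is why D and U
-- anticommute. The obstacle to a proof of D U + U D = 1 by rows is that the tail of a shape may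
-- only grow as far as the row above allows. Hence `add` carries a predicate `p` on the length of
-- its first row, and the induction proves that the anticommutator is the indicator of "the first
-- row may grow", which is 1 when `p` is constantly true. The sign in `U` comes from the reading
-- order. The largest entry, placed at a corner, is inverted exactly with the cells in later rows.
-- Some of these lie in the skew shape, the others in the inner shape filled by `T₀`; their total
-- number does not depend on the inner shape, so a single operator serves all of them.

⟦_⟧ : Bool → ℤ
⟦ true ⟧ = 1ℤ
⟦ false ⟧ = 0ℤ

⟦⟧-cong : ∀ b {x y} → (T b → x ≡ y) → ⟦ b ⟧ *ℤ x ≡ ⟦ b ⟧ *ℤ y
⟦⟧-cong true  e = cong (1ℤ *ℤ_) (e tt)
⟦⟧-cong false e = refl

⟦⟧-true : ∀ {b} → T b → ⟦ b ⟧ ≡ 1ℤ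
⟦⟧-true {true} _ = refl

neg1^-+ : ∀ a b → neg1^ (a + b) ≡ neg1^ a *ℤ neg1^ b
neg1^-+ zero b = sym (*-identityˡ (neg1^ b))
neg1^-+ (suc a) b = trans (cong -_ (neg1^-+ a b)) (neg-distribˡ-* (neg1^ a) (neg1^ b))

neg1^-square : ∀ a → neg1^ a *ℤ neg1^ a ≡ 1ℤ
neg1^-square zero = refl
neg1^-square (suc a) = trans (lem (neg1^ a)) (neg1^-square a)
  where
  lem : ∀ x → - x *ℤ - x ≡ x *ℤ x
  lem = solve-∀

hd : List ℕ → ℕ
hd [] = 0
hd (x ∷ _) = x

Part : List ℕ → Set
Part [] = ⊤
Part (x ∷ xs) = 1 ≤ x × hd xs ≤ x × Part xs

Shapes : Set
Shapes = List ℕ → ℤ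

s : List ℕ → ℤ
s xs = neg1^ (size xs)

-- Partitions have no zero parts, so a row that becomes empty disappears.
trim : ℕ → List ℕ → List ℕ
trim zero xs = xs
trim (suc x) xs = suc x ∷ xs

-- The test `hd xs <ᵇ x` says that the first row ends in a corner. For a partition with x = 1 it
-- forces `xs` to be empty, so `trim` only ever drops a last row there.
U : Shapes → Shapes
U f [] = 0ℤ
U f (x ∷ xs) = ⟦ hd xs <ᵇ x ⟧ *ℤ (s xs *ℤ f (trim (pred x) xs)) +ℤ U (f ∘ (x ∷_)) xs

-- p decides whether a first row of the given length may be extended.  ε = 1 gives the adjoint of U;
-- ε = -1 builds in the twist by (-1)^v, which alternates from row to row.
add : ℤ → (ℕ → Bool) → Shapes → Shapes
add ε p f [] = ⟦ p 0 ⟧ *ℤ f (1 ∷ [])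
add ε p f (x ∷ xs) = ⟦ p x ⟧ *ℤ (s xs *ℤ f (suc x ∷ xs)) +ℤ ε *ℤ add ε (_<ᵇ x) (f ∘ (x ∷_)) xs

U-+ : ∀ f g xs → U (λ κ → f κ +ℤ g κ) xs ≡ U f xs +ℤ U g xs
U-+ f g [] = refl
U-+ f g (x ∷ xs) =
  trans (cong (h *ℤ (s xs *ℤ (f κ +ℤ g κ)) +ℤ_) (U-+ (f ∘ (x ∷_)) (g ∘ (x ∷_)) xs))
        (lem h (s xs) (f κ) (g κ) (U (f ∘ (x ∷_)) xs) (U (g ∘ (x ∷_)) xs))
  where
  h = ⟦ hd xs <ᵇ x ⟧
  κ = trim (pred x) xs
  lem : ∀ h s a b u w → h *ℤ (s *ℤ (a +ℤ b)) +ℤ (u +ℤ w) ≡ (h *ℤ (s *ℤ a) +ℤ u) +ℤ (h *ℤ (s *ℤ b) +ℤ w)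
  lem = solve-∀

U-* : ∀ c f xs → U (λ κ → c *ℤ f κ) xs ≡ c *ℤ U f xs
U-* c f [] = sym (*-zeroʳ c)
U-* c f (x ∷ xs) =
  trans (cong (h *ℤ (s xs *ℤ (c *ℤ f κ)) +ℤ_) (U-* c (f ∘ (x ∷_)) xs))
        (lem c h (s xs) (f κ) (U (f ∘ (x ∷_)) xs))
  where
  h = ⟦ hd xs <ᵇ x ⟧
  κ = trim (pred x) xs
  lem : ∀ c h s a u → h *ℤ (s *ℤ (c *ℤ a)) +ℤ c *ℤ u ≡ c *ℤ (h *ℤ (s *ℤ a) +ℤ u)
  lem = solve-∀

add-+ : ∀ ε p f g xs → add ε p (λ κ → f κ +ℤ g κ) xs ≡ add ε p f xs +ℤ add ε p g xs
add-+ ε p f g [] = lem ⟦ p 0 ⟧ (f (1 ∷ [])) (g (1 ∷ []))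
  where
  lem : ∀ h a b → h *ℤ (a +ℤ b) ≡ h *ℤ a +ℤ h *ℤ b
  lem = solve-∀
add-+ ε p f g (x ∷ xs) =
  trans (cong (λ z → ⟦ p x ⟧ *ℤ (s xs *ℤ (f κ +ℤ g κ)) +ℤ ε *ℤ z) (add-+ ε (_<ᵇ x) (f ∘ (x ∷_)) (g ∘ (x ∷_)) xs))
        (lem ε ⟦ p x ⟧ (s xs) (f κ) (g κ) (add ε (_<ᵇ x) (f ∘ (x ∷_)) xs) (add ε (_<ᵇ x) (g ∘ (x ∷_)) xs))
  where
  κ = suc x ∷ xs
  lem : ∀ ε h s a b u w → h *ℤ (s *ℤ (a +ℤ b)) +ℤ ε *ℤ (u +ℤ w)
      ≡ (h *ℤ (s *ℤ a) +ℤ ε *ℤ u) +ℤ (h *ℤ (s *ℤ b) +ℤ ε *ℤ w)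
  lem = solve-∀

add-* : ∀ ε p c f xs → add ε p (λ κ → c *ℤ f κ) xs ≡ c *ℤ add ε p f xs
add-* ε p c f [] = lem ⟦ p 0 ⟧ c (f (1 ∷ []))
  where
  lem : ∀ h c a → h *ℤ (c *ℤ a) ≡ c *ℤ (h *ℤ a)
  lem = solve-∀
add-* ε p c f (x ∷ xs) =
  trans (cong (λ z → ⟦ p x ⟧ *ℤ (s xs *ℤ (c *ℤ f κ)) +ℤ ε *ℤ z) (add-* ε (_<ᵇ x) c (f ∘ (x ∷_)) xs))
        (lem ε ⟦ p x ⟧ (s xs) c (f κ) (add ε (_<ᵇ x) (f ∘ (x ∷_)) xs))
  where
  κ = suc x ∷ xs
  lem : ∀ ε h s c a u → h *ℤ (s *ℤ (c *ℤ a)) +ℤ ε *ℤ (c *ℤ u) ≡ c *ℤ (h *ℤ (s *ℤ a) +ℤ ε *ℤ u)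
  lem = solve-∀

-- The two operators act on different arguments of `f`, so linearity alone makes them commute.
U-add : ∀ ε p (f : List ℕ → Shapes) xs ys →
        U (λ κ → add ε p (f κ) ys) xs ≡ add ε p (λ η → U (λ κ → f κ η) xs) ys
U-add ε p f xs [] = U-* ⟦ p 0 ⟧ (λ κ → f κ (1 ∷ [])) xs
U-add ε p f xs (y ∷ ys) = begin
  U (λ κ → ⟦ p y ⟧ *ℤ (s ys *ℤ f κ (suc y ∷ ys)) +ℤ ε *ℤ add ε (_<ᵇ y) (f κ ∘ (y ∷_)) ys) xs
    ≡⟨ U-+ _ _ xs ⟩
  U (λ κ → ⟦ p y ⟧ *ℤ (s ys *ℤ f κ (suc y ∷ ys))) xs +ℤ U (λ κ → ε *ℤ add ε (_<ᵇ y) (f κ ∘ (y ∷_)) ys) xs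
    ≡⟨ cong₂ _+ℤ_ (trans (U-* ⟦ p y ⟧ _ xs) (cong (⟦ p y ⟧ *ℤ_) (U-* (s ys) _ xs)))
                  (trans (U-* ε _ xs) (cong (ε *ℤ_) (U-add ε (_<ᵇ y) (λ κ → f κ ∘ (y ∷_)) xs ys))) ⟩
  ⟦ p y ⟧ *ℤ (s ys *ℤ U (λ κ → f κ (suc y ∷ ys)) xs)
    +ℤ ε *ℤ add ε (_<ᵇ y) (λ η → U (λ κ → f κ (y ∷ η)) xs) ys ∎

_⋖_ : List ℕ → List ℕ → Set
κ ⋖ ν = Part κ × suc (size κ) ≡ size ν × T (containedᵇ κ ν)

containedᵇ-refl : ∀ xs → T (containedᵇ xs xs)
containedᵇ-refl [] = tt
containedᵇ-refl (x ∷ xs) with x ≤ᵇ x | ≤⇒≤ᵇ (≤-refl {x})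
... | true | _ = containedᵇ-refl xs

∧-intro : ∀ {a b} → T a → T b → T (a ∧ b)
∧-intro {true} _ q = q

∧-elim : ∀ {a b} → T (a ∧ b) → T a × T b
∧-elim {true} q = tt , q

containedᵇ-hd : ∀ κ ν → T (containedᵇ κ ν) → hd κ ≤ hd ν
containedᵇ-hd [] ν _ = z≤n
containedᵇ-hd (x ∷ κ) (y ∷ ν) q = ≤ᵇ⇒≤ x y (proj₁ (∧-elim q))

trim-⋖ : ∀ x xs → Part (x ∷ xs) → T (hd xs <ᵇ x) → trim (pred x) xs ⋖ (x ∷ xs)
trim-⋖ (suc zero) [] _ _ = tt , refl , tt
trim-⋖ (suc zero) (y ∷ xs) (_ , _ , 1≤y , _) q with ≤-trans 1≤y (≤-pred (<ᵇ⇒< y 1 q))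
... | ()
trim-⋖ (suc (suc x)) xs (_ , _ , P) q =
  (s≤s z≤n , ≤-pred (<ᵇ⇒< (hd xs) (suc (suc x)) q) , P) , refl ,
  ∧-intro (≤⇒≤ᵇ (n≤1+n (suc x))) (containedᵇ-refl xs)

∷-⋖ : ∀ x {κ xs} → Part (x ∷ xs) → κ ⋖ xs → (x ∷ κ) ⋖ (x ∷ xs)
∷-⋖ x {κ} {xs} (1≤x , h≤x , _) (Pκ , e , c) =
  (1≤x , ≤-trans (containedᵇ-hd κ xs c) h≤x , Pκ) ,
  trans (sym (+-suc x (size κ))) (cong (λ k → x + k) e) ,
  ∧-intro (≤⇒≤ᵇ (≤-refl {x})) c

-- `U` reads its argument only at shapes covered by ν. This takes the place of function
-- extensionality and hands the facts about κ to every rewriting under `U`.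
U-cong : ∀ {f g} ν → Part ν → (∀ κ → κ ⋖ ν → f κ ≡ g κ) → U f ν ≡ U g ν
U-cong [] _ _ = refl
U-cong (x ∷ xs) P e = cong₂ _+ℤ_
  (⟦⟧-cong (hd xs <ᵇ x) λ q → cong (s xs *ℤ_) (e _ (trim-⋖ x xs P q)))
  (U-cong xs (proj₂ (proj₂ P)) λ κ q → e _ (∷-⋖ x P q))

-- The disjunction records whether the first row stayed as it was or grew with the permission of
-- `p`. The recursive call needs it to see that the enlarged tail still fits under the row x.
add-cong : ∀ ε p {f g} ν → Part ν →
           (∀ κ → Part κ → size κ ≡ suc (size ν) → hd κ ≤ hd ν ⊎ T (p (pred (hd κ))) → f κ ≡ g κ) →
           add ε p f ν ≡ add ε p g ν
add-cong ε p [] _ e = ⟦⟧-cong (p 0) λ q → e _ (s≤s z≤n , z≤n , tt) refl (inj₂ q)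
add-cong ε p (x ∷ xs) (1≤x , h≤x , P) e = cong₂ _+ℤ_
  (⟦⟧-cong (p x) λ q → cong (s xs *ℤ_) (e _ (s≤s z≤n , m≤n⇒m≤1+n h≤x , P) refl (inj₂ q)))
  (cong (ε *ℤ_) (add-cong ε (_<ᵇ x) xs P λ κ Pκ eq b →
    e (x ∷ κ) (1≤x , bound κ b , Pκ) (trans (cong (λ k → x + k) eq) (+-suc x (size xs))) (inj₁ ≤-refl)))
  where
  bound : ∀ κ → hd κ ≤ hd xs ⊎ T (pred (hd κ) <ᵇ x) → hd κ ≤ x
  bound κ (inj₁ q) = ≤-trans q h≤x
  bound [] (inj₂ _) = z≤n
  bound (zero ∷ κ) (inj₂ _) = z≤n
  bound (suc y ∷ κ) (inj₂ q) = <ᵇ⇒< y x q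

-- All shapes that are read have exactly one cell less, so `s` is constant on them. The minus sign
-- here and in `add-s` is the source of the anticommutation.
U-s : ∀ f xs → Part xs → U (λ κ → s κ *ℤ f κ) xs ≡ - (s xs *ℤ U f xs)
U-s f xs P = begin
  U (λ κ → s κ *ℤ f κ) xs        ≡⟨ U-cong xs P (λ κ (_ , e , _) → cong (_*ℤ f κ) (flip κ e)) ⟩
  U (λ κ → - s xs *ℤ f κ) xs     ≡⟨ U-* (- s xs) f xs ⟩
  - s xs *ℤ U f xs               ≡⟨ neg-distribˡ-* (s xs) (U f xs) ⟨
  - (s xs *ℤ U f xs)             ∎
  where
  flip : ∀ κ → suc (size κ) ≡ size xs → s κ ≡ - s xs
  flip κ e = trans (sym (neg-involutive (s κ))) (cong (λ k → - neg1^ k) e)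

add-s : ∀ ε p f xs → Part xs → add ε p (λ κ → s κ *ℤ f κ) xs ≡ - (s xs *ℤ add ε p f xs)
add-s ε p f xs P = begin
  add ε p (λ κ → s κ *ℤ f κ) xs     ≡⟨ add-cong ε p xs P (λ κ _ e _ → cong (λ k → neg1^ k *ℤ f κ) e) ⟩
  add ε p (λ κ → - s xs *ℤ f κ) xs  ≡⟨ add-* ε p (- s xs) f xs ⟩
  - s xs *ℤ add ε p f xs            ≡⟨ neg-distribˡ-* (s xs) (add ε p f xs) ⟨
  - (s xs *ℤ add ε p f xs)          ∎

-- A cell is added below a row of length x + 1 that must still end in a corner afterwards. This
-- amounts to growing under a row of length x, provided that `xs` fitted there already.
add-bound : ∀ ε x F xs → add ε (_<ᵇ suc x) (λ κ → ⟦ hd κ <ᵇ suc x ⟧ *ℤ F κ) xs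
                       ≡ ⟦ hd xs <ᵇ suc x ⟧ *ℤ add ε (_<ᵇ x) F xs
add-bound ε x F [] = refl
add-bound ε x F (y ∷ ys) =
  trans (cong (λ z → h *ℤ (s ys *ℤ (⟦ y <ᵇ x ⟧ *ℤ F (suc y ∷ ys))) +ℤ ε *ℤ z) (add-* ε (_<ᵇ y) h (F ∘ (y ∷_)) ys))
        (lem ε h (s ys) ⟦ y <ᵇ x ⟧ (F (suc y ∷ ys)) (add ε (_<ᵇ y) (F ∘ (y ∷_)) ys))
  where
  h = ⟦ y <ᵇ suc x ⟧
  lem : ∀ ε h s w a b → h *ℤ (s *ℤ (w *ℤ a)) +ℤ ε *ℤ (h *ℤ b) ≡ h *ℤ (w *ℤ (s *ℤ a) +ℤ ε *ℤ b)
  lem = solve-∀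

-- For x = 0 the row has vanished, yet the formula persists: the empty shape grows like a row of
-- length 0, and the bound `_<ᵇ 0` kills the tail term.
add-trim : ∀ ε p g x xs → Part xs → hd xs ≤ x →
           add ε p g (trim x xs) ≡ ⟦ p x ⟧ *ℤ (s xs *ℤ g (suc x ∷ xs)) +ℤ ε *ℤ add ε (_<ᵇ x) (g ∘ trim x) xs
add-trim ε p g zero [] _ _ = lem ε ⟦ p 0 ⟧ (g (1 ∷ [])) (g (1 ∷ []))
  where
  lem : ∀ ε h a b → h *ℤ a ≡ h *ℤ (1ℤ *ℤ a) +ℤ ε *ℤ (0ℤ *ℤ b)
  lem = solve-∀
add-trim ε p g zero (y ∷ xs) (1≤y , _) y≤0 with ≤-trans 1≤y y≤0
... | ()
add-trim ε p g (suc x) xs _ _ = refl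

-- The mixed terms cancel in pairs; the diagonal ones telescope along the rows.
add-U+U-add : ∀ p f ν → Part ν → (1 ≤ hd ν → T (p (pred (hd ν)))) →
              add -1ℤ p (U f) ν +ℤ U (add -1ℤ p f) ν ≡ ⟦ p (hd ν) ⟧ *ℤ f ν
add-U+U-add p f [] _ _ = lem ⟦ p 0 ⟧ (f [])
  where
  lem : ∀ h a → h *ℤ (1ℤ *ℤ (1ℤ *ℤ a) +ℤ 0ℤ) +ℤ 0ℤ ≡ h *ℤ a
  lem = solve-∀
add-U+U-add p f (suc x ∷ xs) (_ , h≤ , P) px = begin
  w *ℤ (σ *ℤ U f (suc (suc x) ∷ xs)) +ℤ -1ℤ *ℤ add -1ℤ (_<ᵇ suc x) (λ κ → U f (suc x ∷ κ)) xs
    +ℤ U (add -1ℤ p f) (suc x ∷ xs)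
    ≡⟨ cong₂ (λ a b → w *ℤ (σ *ℤ a) +ℤ -1ℤ *ℤ b +ℤ U (add -1ℤ p f) (suc x ∷ xs)) upper lower ⟩
  w *ℤ (σ *ℤ (1ℤ *ℤ (σ *ℤ f₀) +ℤ u)) +ℤ -1ℤ *ℤ (h *ℤ (- (σ *ℤ d)) +ℤ DU)
    +ℤ (h *ℤ (σ *ℤ add -1ℤ p f (trim x xs)) +ℤ U (λ κ → add -1ℤ p f (suc x ∷ κ)) xs)
    ≡⟨ cong₂ (λ a b → w *ℤ (σ *ℤ (1ℤ *ℤ (σ *ℤ f₀) +ℤ u)) +ℤ -1ℤ *ℤ (h *ℤ (- (σ *ℤ d)) +ℤ DU) +ℤ (a +ℤ b)) diag rest ⟩
  w *ℤ (σ *ℤ (1ℤ *ℤ (σ *ℤ f₀) +ℤ u)) +ℤ -1ℤ *ℤ (h *ℤ (- (σ *ℤ d)) +ℤ DU)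
    +ℤ (h *ℤ (σ *ℤ (1ℤ *ℤ (σ *ℤ f₀) +ℤ -1ℤ *ℤ d)) +ℤ (w *ℤ (- (σ *ℤ u)) +ℤ -1ℤ *ℤ UD))
    -- The terms with `u` extend the first row and remove a cell below it, in either order; those
    -- with `d` shorten it and add a cell below. Each pair cancels. The terms with `f₀` extend and
    -- shorten the first row itself.
    ≡⟨ collect w h σ f₀ u d DU UD ⟩
  (w +ℤ h) *ℤ (σ *ℤ σ) *ℤ f₀ - (DU +ℤ UD)
    -- The tail may grow exactly while it is shorter than the first row, which is also the condition
    -- `h` for the first row to end in a corner. So the induction hypothesis cancels the `h` term.
    ≡⟨ cong₂ (λ a b → (w +ℤ h) *ℤ a *ℤ f₀ - b) (neg1^-square (size xs))
             (add-U+U-add (_<ᵇ suc x) (f ∘ (suc x ∷_)) xs P λ 1≤ → <⇒<ᵇ (below xs 1≤ h≤)) ⟩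
  (w +ℤ h) *ℤ 1ℤ *ℤ f₀ - h *ℤ f₀
    ≡⟨ telescope w h f₀ ⟩
  w *ℤ f₀ ∎
  where
  w = ⟦ p (suc x) ⟧
  h = ⟦ hd xs <ᵇ suc x ⟧
  σ = s xs
  f₀ = f (suc x ∷ xs)
  u = U (f ∘ (suc (suc x) ∷_)) xs
  d = add -1ℤ (_<ᵇ x) (f ∘ trim x) xs
  DU = add -1ℤ (_<ᵇ suc x) (U (f ∘ (suc x ∷_))) xs
  UD = U (add -1ℤ (_<ᵇ suc x) (f ∘ (suc x ∷_))) xs
  below : ∀ ys → 1 ≤ hd ys → hd ys ≤ suc x → pred (hd ys) < suc x
  below (suc y ∷ ys) _ q = q
  upper : U f (suc (suc x) ∷ xs) ≡ 1ℤ *ℤ (σ *ℤ f₀) +ℤ u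
  upper = cong (λ b → b *ℤ (σ *ℤ f₀) +ℤ u) (⟦⟧-true (<⇒<ᵇ (s≤s h≤)))
  lower : add -1ℤ (_<ᵇ suc x) (λ κ → U f (suc x ∷ κ)) xs ≡ h *ℤ (- (σ *ℤ d)) +ℤ DU
  lower = trans (add-+ -1ℤ (_<ᵇ suc x) _ _ xs)
    (cong (_+ℤ DU) (trans (add-bound -1ℤ x (λ κ → s κ *ℤ f (trim x κ)) xs)
                          (cong (h *ℤ_) (add-s -1ℤ (_<ᵇ x) (f ∘ trim x) xs P))))
  diag : h *ℤ (σ *ℤ add -1ℤ p f (trim x xs)) ≡ h *ℤ (σ *ℤ (1ℤ *ℤ (σ *ℤ f₀) +ℤ -1ℤ *ℤ d))
  diag = ⟦⟧-cong (hd xs <ᵇ suc x) λ q → cong (σ *ℤ_)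
    (trans (add-trim -1ℤ p f x xs P (≤-pred (<ᵇ⇒< (hd xs) (suc x) q)))
           (cong (λ b → b *ℤ (σ *ℤ f₀) +ℤ -1ℤ *ℤ d) (⟦⟧-true (px (s≤s z≤n)))))
  rest : U (λ κ → add -1ℤ p f (suc x ∷ κ)) xs ≡ w *ℤ (- (σ *ℤ u)) +ℤ -1ℤ *ℤ UD
  rest = trans (U-+ _ _ xs) (cong₂ _+ℤ_
    (trans (U-* w _ xs) (cong (w *ℤ_) (U-s _ xs P))) (U-* -1ℤ _ xs))
  collect : ∀ w h σ f₀ u d DU UD →
    w *ℤ (σ *ℤ (1ℤ *ℤ (σ *ℤ f₀) +ℤ u)) +ℤ -1ℤ *ℤ (h *ℤ (- (σ *ℤ d)) +ℤ DU)
    +ℤ (h *ℤ (σ *ℤ (1ℤ *ℤ (σ *ℤ f₀) +ℤ -1ℤ *ℤ d)) +ℤ (w *ℤ (- (σ *ℤ u)) +ℤ -1ℤ *ℤ UD))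
    ≡ (w +ℤ h) *ℤ (σ *ℤ σ) *ℤ f₀ - (DU +ℤ UD)
  collect = solve-∀
  telescope : ∀ w h f₀ → (w +ℤ h) *ℤ 1ℤ *ℤ f₀ - h *ℤ f₀ ≡ w *ℤ f₀
  telescope = solve-∀

-- Normal ordering of powers of D and U

D : Shapes → Shapes
D = add -1ℤ (const true)

infix 4 _≈_
_≈_ : Shapes → Shapes → Set
f ≈ g = ∀ κ → Part κ → f κ ≡ g κ

U-resp : ∀ {f g} → f ≈ g → U f ≈ U g
U-resp e ν P = U-cong ν P λ κ q → e κ (proj₁ q)

D-resp : ∀ {f g} → f ≈ g → D f ≈ D g
D-resp e ν P = add-cong -1ℤ _ ν P λ κ q _ _ → e κ q

D-U : ∀ f → D (U f) ≈ λ ν → f ν - U (D f) ν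
D-U f ν P = trans (lem (D (U f) ν) (U (D f) ν))
  (cong (_- U (D f) ν) (trans (add-U+U-add (const true) f ν P (const tt)) (*-identityˡ (f ν))))
  where
  lem : ∀ a b → a ≡ (a +ℤ b) - b
  lem = solve-∀

U^ D^ : ℕ → Shapes → Shapes
U^ m f = fold f U m
D^ n f = fold f D n

D^-resp : ∀ m {f g} → f ≈ g → D^ m f ≈ D^ m g
D^-resp zero e = e
D^-resp (suc m) e = D-resp (D^-resp m e)

U-linear : ∀ a b f g → U (λ κ → a *ℤ f κ +ℤ b *ℤ g κ) ≈ λ κ → a *ℤ U f κ +ℤ b *ℤ U g κ
U-linear a b f g ν _ = trans (U-+ _ _ ν) (cong₂ _+ℤ_ (U-* a f ν) (U-* b g ν))

D-linear : ∀ a b f g → D (λ κ → a *ℤ f κ +ℤ b *ℤ g κ) ≈ λ κ → a *ℤ D f κ +ℤ b *ℤ D g κ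
D-linear a b f g ν _ = trans (add-+ _ _ _ _ ν) (cong₂ _+ℤ_ (add-* _ _ a f ν) (add-* _ _ b g ν))

-- 1or0 m = (1 - (-1)^m) / 2
1or0 : ℕ → ℤ
1or0 zero = 0ℤ
1or0 (suc m) = neg1^ m +ℤ 1or0 m

data Parity (m : ℕ) : Set where
  even : neg1^ m ≡ 1ℤ → 1or0 m ≡ 0ℤ → Parity m
  odd  : neg1^ m ≡ -1ℤ → 1or0 m ≡ 1ℤ → Parity m

parity : ∀ m → Parity m
parity zero = even refl refl
parity (suc m) with parity m
... | even p q = odd (cong -_ p) (cong₂ _+ℤ_ p q)
... | odd p q = even (cong -_ p) (cong₂ _+ℤ_ p q)

-- Each further `U` flips the sign of the first term and turns the coefficient c of the second into
-- 1 - c, so c alternates between 0 and 1.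
D-U^ : ∀ m f → D (U^ m f) ≈ λ κ → neg1^ m *ℤ U^ m (D f) κ +ℤ 1or0 m *ℤ U^ (m ∸ 1) f κ
D-U^ zero f κ _ = lem (D f κ) (f κ)
  where
  lem : ∀ a b → a ≡ 1ℤ *ℤ a +ℤ 0ℤ *ℤ b
  lem = solve-∀
D-U^ (suc m) f κ P = begin
  D (U (U^ m f)) κ
    ≡⟨ D-U (U^ m f) κ P ⟩
  U^ m f κ - U (D (U^ m f)) κ
    ≡⟨ cong (λ z → U^ m f κ - z) (trans (U-resp (D-U^ m f) κ P) (U-linear (neg1^ m) (1or0 m) _ _ κ P)) ⟩
  U^ m f κ - (neg1^ m *ℤ U^ (suc m) (D f) κ +ℤ 1or0 m *ℤ U^ (suc (m ∸ 1)) f κ)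
    -- At m = 0 the truncated exponent `suc (m ∸ 1)` differs from m, but there the coefficient is 0.
    ≡⟨ cong (λ z → U^ m f κ - (neg1^ m *ℤ U^ (suc m) (D f) κ +ℤ z)) (shift m) ⟩
  U^ m f κ - (neg1^ m *ℤ U^ (suc m) (D f) κ +ℤ 1or0 m *ℤ U^ m f κ)
    ≡⟨ lem (U^ m f κ) (neg1^ m) (U^ (suc m) (D f) κ) (1or0 m) ⟩
  - neg1^ m *ℤ U^ (suc m) (D f) κ +ℤ (1ℤ - 1or0 m) *ℤ U^ m f κ
    ≡⟨ cong (λ z → - neg1^ m *ℤ U^ (suc m) (D f) κ +ℤ z *ℤ U^ m f κ) (complement m) ⟩
  - neg1^ m *ℤ U^ (suc m) (D f) κ +ℤ (neg1^ m +ℤ 1or0 m) *ℤ U^ m f κ ∎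
  where
  shift : ∀ k → 1or0 k *ℤ U^ (suc (k ∸ 1)) f κ ≡ 1or0 k *ℤ U^ k f κ
  shift zero = refl
  shift (suc k) = refl
  complement : ∀ k → 1ℤ - 1or0 k ≡ neg1^ k +ℤ 1or0 k
  complement k with parity k
  ... | even p q rewrite p | q = refl
  ... | odd p q rewrite p | q = refl
  lem : ∀ u n a o → u - (n *ℤ a +ℤ o *ℤ u) ≡ - n *ℤ a +ℤ (1ℤ - o) *ℤ u
  lem = solve-∀

D-U^-even : ∀ m f → neg1^ m ≡ 1ℤ → D (U^ m f) ≈ U^ m (D f)
D-U^-even m f e κ P with parity m
... | even p q = trans (D-U^ m f κ P) (trans (cong₂ (λ a b → a *ℤ U^ m (D f) κ +ℤ b *ℤ U^ (m ∸ 1) f κ) p q) (lem _ (U^ (m ∸ 1) f κ)))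
  where
  lem : ∀ a b → 1ℤ *ℤ a +ℤ 0ℤ *ℤ b ≡ a
  lem = solve-∀
... | odd p q with trans (sym e) p
... | ()

D^-U^-even : ∀ m n f → neg1^ m ≡ 1ℤ → D^ n (U^ m f) ≈ U^ m (D^ n f)
D^-U^-even m zero f e κ P = refl
D^-U^-even m (suc n) f e κ P = trans (D-resp (D^-U^-even m n f e) κ P) (D-U^-even m (D^ n f) e κ P)

-- `D` commutes with the even power `U^ m`, so D U^(m+1) = U^m - U^(m+1) D: the odd power behaves
-- towards `D` like a single `U`, with U^m in place of the identity. The induction on n then mirrors
-- `D-U^`.
D^-U^-odd : ∀ m n f → neg1^ m ≡ 1ℤ →
  D^ n (U^ (suc m) f) ≈ λ κ → neg1^ n *ℤ U^ (suc m) (D^ n f) κ +ℤ 1or0 n *ℤ U^ m (D^ (n ∸ 1) f) κ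
D^-U^-odd m zero f e κ P = lem (U^ (suc m) f κ) (U^ m f κ)
  where
  lem : ∀ a b → a ≡ 1ℤ *ℤ a +ℤ 0ℤ *ℤ b
  lem = solve-∀
D^-U^-odd m (suc n) f e κ P = begin
  D (D^ n (U^ (suc m) f)) κ
    ≡⟨ trans (D-resp (D^-U^-odd m n f e) κ P) (D-linear (neg1^ n) (1or0 n) _ _ κ P) ⟩
  neg1^ n *ℤ D (U^ (suc m) (D^ n f)) κ +ℤ 1or0 n *ℤ D (U^ m (D^ (n ∸ 1) f)) κ
    ≡⟨ cong₂ (λ a b → neg1^ n *ℤ a +ℤ 1or0 n *ℤ b)
         (trans (D-U (U^ m (D^ n f)) κ P)
                (cong (λ z → U^ m (D^ n f) κ - z) (U-resp (D-U^-even m (D^ n f) e) κ P)))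
         (D-U^-even m (D^ (n ∸ 1) f) e κ P) ⟩
  neg1^ n *ℤ (U^ m (D^ n f) κ - U^ (suc m) (D^ (suc n) f) κ) +ℤ 1or0 n *ℤ U^ m (D (D^ (n ∸ 1) f)) κ
    ≡⟨ cong (neg1^ n *ℤ (U^ m (D^ n f) κ - U^ (suc m) (D^ (suc n) f) κ) +ℤ_) (shift n) ⟩
  neg1^ n *ℤ (U^ m (D^ n f) κ - U^ (suc m) (D^ (suc n) f) κ) +ℤ 1or0 n *ℤ U^ m (D^ n f) κ
    ≡⟨ lem (neg1^ n) (U^ m (D^ n f) κ) (U^ (suc m) (D^ (suc n) f) κ) (1or0 n) ⟩
  - neg1^ n *ℤ U^ (suc m) (D^ (suc n) f) κ +ℤ (neg1^ n +ℤ 1or0 n) *ℤ U^ m (D^ n f) κ ∎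
  where
  shift : ∀ k → 1or0 k *ℤ U^ m (D (D^ (k ∸ 1) f)) κ ≡ 1or0 k *ℤ U^ m (D^ k f) κ
  shift zero = refl
  shift (suc k) = refl
  lem : ∀ n u d o → n *ℤ (u - d) +ℤ o *ℤ u ≡ - n *ℤ d +ℤ (n +ℤ o) *ℤ u
  lem = solve-∀

neg1^-*-even : ∀ m n → neg1^ m ≡ 1ℤ → neg1^ (m * n) ≡ 1ℤ
neg1^-*-even m zero e = cong neg1^ (ℕₚ.*-zeroʳ m)
neg1^-*-even m (suc n) e = trans (cong neg1^ (ℕₚ.*-suc m n)) (trans (neg1^-+ m (m * n)) (cong₂ _*ℤ_ e (neg1^-*-even m n e)))

-- For even m the product mn is even, and for odd m it has the parity of n, so the two cases share
-- one formula in mn. If m or n is 0 the second coefficient is 0, which makes the truncated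
-- exponents harmless. The division evaluates once the sign is a literal.
D^-U^ : ∀ m n f → D^ n (U^ m f) ≈ λ κ →
        neg1^ (m * n) *ℤ U^ m (D^ n f) κ
        +ℤ ((1ℤ - neg1^ (m * n)) / (+ 2)) *ℤ U^ (m ∸ 1) (D^ (n ∸ 1) f) κ
D^-U^ m n f κ P with parity m
... | even p _ rewrite neg1^-*-even m n p = trans (D^-U^-even m n f p κ P) (lem _ (U^ (m ∸ 1) (D^ (n ∸ 1) f) κ))
  where
  lem : ∀ a b → a ≡ 1ℤ *ℤ a +ℤ 0ℤ *ℤ b
  lem = solve-∀
D^-U^ (suc m) n f κ P | odd p _ = trans (D^-U^-odd m n f p′ κ P)
  (cong₂ (λ a b → a *ℤ U^ (suc m) (D^ n f) κ +ℤ b *ℤ U^ m (D^ (n ∸ 1) f) κ) same half)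
  where
  p′ : neg1^ m ≡ 1ℤ
  p′ = trans (sym (neg-involutive (neg1^ m))) (cong -_ p)
  same : neg1^ n ≡ neg1^ (n + m * n)
  same = sym (trans (neg1^-+ n (m * n)) (trans (cong (neg1^ n *ℤ_) (neg1^-*-even m n p′)) (*-identityʳ _)))
  half : 1or0 n ≡ (1ℤ - neg1^ (n + m * n)) / (+ 2)
  half with parity n
  ... | even a b rewrite sym same | a = b
  ... | odd a b rewrite sym same | a = b

-- Adjointness of U and D

eqᵇ : List ℕ → List ℕ → Bool
eqᵇ [] [] = true
eqᵇ [] (_ ∷ _) = false
eqᵇ (_ ∷ _) [] = false
eqᵇ (x ∷ xs) (y ∷ ys) = (x ≡ᵇ y) ∧ eqᵇ xs ys

δ : List ℕ → Shapes
δ β κ = ⟦ eqᵇ β κ ⟧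

≡ᵇ-sym : ∀ x y → (x ≡ᵇ y) ≡ (y ≡ᵇ x)
≡ᵇ-sym zero zero = refl
≡ᵇ-sym zero (suc y) = refl
≡ᵇ-sym (suc x) zero = refl
≡ᵇ-sym (suc x) (suc y) = ≡ᵇ-sym x y

eqᵇ-sym : ∀ xs ys → eqᵇ xs ys ≡ eqᵇ ys xs
eqᵇ-sym [] [] = refl
eqᵇ-sym [] (_ ∷ _) = refl
eqᵇ-sym (_ ∷ _) [] = refl
eqᵇ-sym (x ∷ xs) (y ∷ ys) = cong₂ _∧_ (≡ᵇ-sym x y) (eqᵇ-sym xs ys)

eqᵇ-≡ : ∀ xs ys → T (eqᵇ xs ys) → xs ≡ ys
eqᵇ-≡ [] [] _ = refl
eqᵇ-≡ (x ∷ xs) (y ∷ ys) q = cong₂ _∷_ (≡ᵇ⇒≡ x y (proj₁ (∧-elim q))) (eqᵇ-≡ xs ys (proj₂ (∧-elim {x ≡ᵇ y} q)))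

⟦⟧-∧ : ∀ a b → ⟦ a ∧ b ⟧ ≡ ⟦ a ⟧ *ℤ ⟦ b ⟧
⟦⟧-∧ true b = sym (*-identityˡ ⟦ b ⟧)
⟦⟧-∧ false b = refl

⟦⟧-absorb : ∀ g e c → (T e → T g) → ⟦ g ⟧ *ℤ (c *ℤ ⟦ e ⟧) ≡ c *ℤ ⟦ e ⟧
⟦⟧-absorb g false c _ = trans (cong (⟦ g ⟧ *ℤ_) (*-zeroʳ c)) (trans (*-zeroʳ ⟦ g ⟧) (sym (*-zeroʳ c)))
⟦⟧-absorb g true c q = trans (cong (_*ℤ (c *ℤ 1ℤ)) (⟦⟧-true (q tt))) (*-identityˡ _)

U-0 : ∀ xs → U (const 0ℤ) xs ≡ 0ℤ
U-0 xs = U-* 0ℤ (const 0ℤ) xs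

add-0 : ∀ ε p xs → add ε p (const 0ℤ) xs ≡ 0ℤ
add-0 ε p xs = add-* ε p 0ℤ (const 0ℤ) xs

-- If ν is β plus a cell, the two shapes agree below the row of that cell, so its sign can be
-- computed from either; otherwise both sides vanish. The condition on `p` lets the first row grow
-- to any length that ν may require.
U-δ : ∀ p ν β → Part ν → Part β → (∀ y → y < hd ν → T (p y)) → U (δ β) ν ≡ add 1ℤ p (δ ν) β
U-δ p [] [] _ _ _ = sym (*-zeroʳ ⟦ p 0 ⟧)
U-δ p [] (y ∷ ys) _ _ _ = sym (trans (cong (λ z → ⟦ p y ⟧ *ℤ (s ys *ℤ 0ℤ) +ℤ 1ℤ *ℤ z) (add-0 1ℤ (_<ᵇ y) ys)) (lem ⟦ p y ⟧ (s ys)))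
  where
  lem : ∀ a b → a *ℤ (b *ℤ 0ℤ) +ℤ 1ℤ *ℤ 0ℤ ≡ 0ℤ
  lem = solve-∀
U-δ p (suc zero ∷ []) [] _ _ q rewrite ⟦⟧-true (q 0 (s≤s z≤n)) = refl
U-δ p (suc zero ∷ suc z ∷ xs) [] _ _ q rewrite U-0 (suc z ∷ xs) = sym (*-zeroʳ ⟦ p 0 ⟧)
U-δ p (suc (suc x) ∷ xs) [] _ _ q rewrite U-0 xs =
  trans (lem ⟦ hd xs <ᵇ suc (suc x) ⟧ (s xs)) (sym (*-zeroʳ ⟦ p 0 ⟧))
  where
  lem : ∀ a b → a *ℤ (b *ℤ 0ℤ) +ℤ 0ℤ ≡ 0ℤ
  lem = solve-∀
U-δ p (x ∷ xs) (suc y ∷ ys) (1≤x , h≤x , P) (_ , h≤y , Q) q = cong₂ _+ℤ_ (first x 1≤x h≤x q) second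
  where
  first : ∀ x → 1 ≤ x → hd xs ≤ x → (∀ z → z < x → T (p z)) →
    ⟦ hd xs <ᵇ x ⟧ *ℤ (s xs *ℤ δ (suc y ∷ ys) (trim (pred x) xs))
    ≡ ⟦ p (suc y) ⟧ *ℤ (s ys *ℤ δ (x ∷ xs) (suc (suc y) ∷ ys))
  first (suc zero) _ h≤ q = trans (top xs P) (sym (lem ⟦ p (suc y) ⟧ (s ys)))
    where
    lem : ∀ a b → a *ℤ (b *ℤ 0ℤ) ≡ 0ℤ
    lem = solve-∀
    top : ∀ xs → Part xs → ⟦ hd xs <ᵇ 1 ⟧ *ℤ (s xs *ℤ δ (suc y ∷ ys) xs) ≡ 0ℤ
    top [] _ = refl
    top (suc z ∷ xs) _ = refl
  first (suc (suc x)) _ h≤ q = begin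
    ⟦ hd xs <ᵇ suc (suc x) ⟧ *ℤ (s xs *ℤ ⟦ e ⟧)
      ≡⟨ ⟦⟧-absorb _ e (s xs) (λ t → let (a , b) = same t in
           subst (λ zs → T (hd zs <ᵇ suc (suc x))) b (<⇒<ᵇ (s≤s (≤-trans h≤y (≤-reflexive (cong suc a)))))) ⟩
    s xs *ℤ ⟦ e ⟧
      ≡⟨ trans (*-comm (s xs) ⟦ e ⟧)
           (trans (⟦⟧-cong e λ t → cong s (sym (proj₂ (same t)))) (*-comm ⟦ e ⟧ (s ys))) ⟩
    s ys *ℤ ⟦ e ⟧
      ≡⟨ ⟦⟧-absorb _ e (s ys) (λ t → q (suc y) (s≤s (≤-reflexive (cong suc (proj₁ (same t)))))) ⟨
    ⟦ p (suc y) ⟧ *ℤ (s ys *ℤ ⟦ e ⟧)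
      ≡⟨ cong (λ b → ⟦ p (suc y) ⟧ *ℤ (s ys *ℤ ⟦ b ⟧)) (eqᵇ-sym (suc y ∷ ys) (suc x ∷ xs)) ⟩
    ⟦ p (suc y) ⟧ *ℤ (s ys *ℤ δ (suc (suc x) ∷ xs) (suc (suc y) ∷ ys)) ∎
    where
    e = eqᵇ (suc y ∷ ys) (suc x ∷ xs)
    same : T e → y ≡ x × ys ≡ xs
    same t = ≡ᵇ⇒≡ y x (proj₁ (∧-elim t)) , eqᵇ-≡ ys xs (proj₂ (∧-elim {y ≡ᵇ x} t))
  second : U (λ κ → δ (suc y ∷ ys) (x ∷ κ)) xs ≡ 1ℤ *ℤ add 1ℤ (_<ᵇ suc y) (λ η → δ (x ∷ xs) (suc y ∷ η)) ys
  second = begin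
    U (λ κ → ⟦ (suc y ≡ᵇ x) ∧ eqᵇ ys κ ⟧) xs
      ≡⟨ U-cong xs P (λ κ _ → ⟦⟧-∧ (suc y ≡ᵇ x) (eqᵇ ys κ)) ⟩
    U (λ κ → ⟦ suc y ≡ᵇ x ⟧ *ℤ δ ys κ) xs
      ≡⟨ U-* ⟦ suc y ≡ᵇ x ⟧ (δ ys) xs ⟩
    ⟦ suc y ≡ᵇ x ⟧ *ℤ U (δ ys) xs
      ≡⟨ ⟦⟧-cong (suc y ≡ᵇ x) (λ t → U-δ (_<ᵇ suc y) xs ys P Q λ z z<h → <⇒<ᵇ
           (≤-trans z<h (≤-trans h≤x (≤-reflexive (sym (≡ᵇ⇒≡ (suc y) x t)))))) ⟩
    ⟦ suc y ≡ᵇ x ⟧ *ℤ add 1ℤ (_<ᵇ suc y) (δ xs) ys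
      ≡⟨ cong (λ b → ⟦ b ⟧ *ℤ add 1ℤ (_<ᵇ suc y) (δ xs) ys) (≡ᵇ-sym (suc y) x) ⟩
    ⟦ x ≡ᵇ suc y ⟧ *ℤ add 1ℤ (_<ᵇ suc y) (δ xs) ys
      ≡⟨ add-* 1ℤ (_<ᵇ suc y) ⟦ x ≡ᵇ suc y ⟧ (δ xs) ys ⟨
    add 1ℤ (_<ᵇ suc y) (λ η → ⟦ x ≡ᵇ suc y ⟧ *ℤ δ xs η) ys
      ≡⟨ add-cong 1ℤ (_<ᵇ suc y) ys Q (λ κ _ _ _ → ⟦⟧-∧ (x ≡ᵇ suc y) (eqᵇ xs κ)) ⟨
    add 1ℤ (_<ᵇ suc y) (λ η → δ (x ∷ xs) (suc y ∷ η)) ys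
      ≡⟨ *-identityˡ _ ⟨
    1ℤ *ℤ add 1ℤ (_<ᵇ suc y) (λ η → δ (x ∷ xs) (suc y ∷ η)) ys ∎

σ : List ℕ → ℤ
σ xs = neg1^ (v xs)

-- Deleting the first row exchanges even and odd rows, so `v (x ∷ xs)` and `v xs` add up to
-- `size xs`.
σ-∷ : ∀ x xs → σ (x ∷ xs) ≡ s xs *ℤ σ xs
σ-∷ x [] = refl
σ-∷ x (y ∷ ys) = begin
  neg1^ (y + v ys)                                      ≡⟨ neg1^-+ y (v ys) ⟩
  neg1^ y *ℤ σ ys                                       ≡⟨ *-identityʳ _ ⟨
  neg1^ y *ℤ σ ys *ℤ 1ℤ                                 ≡⟨ cong (neg1^ y *ℤ σ ys *ℤ_) (neg1^-square (size ys)) ⟨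
  neg1^ y *ℤ σ ys *ℤ (s ys *ℤ s ys)                     ≡⟨ lem (neg1^ y) (σ ys) (s ys) ⟩
  neg1^ y *ℤ s ys *ℤ (s ys *ℤ σ ys)                     ≡⟨ cong₂ _*ℤ_ (neg1^-+ y (size ys)) (σ-∷ y ys) ⟨
  s (y ∷ ys) *ℤ σ (y ∷ ys)                              ∎
  where
  lem : ∀ a b c → a *ℤ b *ℤ (c *ℤ c) ≡ a *ℤ c *ℤ (c *ℤ b)
  lem = solve-∀

-- A new cell changes v only in an even row, so conjugation by `σ` costs a sign for every row that
-- is passed. In the recursion it arises from `σ-∷` together with the minus of `add-s`.
add-σ : ∀ p f xs → Part xs → add 1ℤ p (λ κ → σ κ *ℤ f κ) xs ≡ σ xs *ℤ add -1ℤ p f xs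
add-σ p f [] _ = lem ⟦ p 0 ⟧ (f (1 ∷ []))
  where
  lem : ∀ a b → a *ℤ (1ℤ *ℤ b) ≡ 1ℤ *ℤ (a *ℤ b)
  lem = solve-∀
add-σ p f (x ∷ xs) (_ , _ , P) = begin
  ⟦ p x ⟧ *ℤ (s xs *ℤ (σ (suc x ∷ xs) *ℤ f₀)) +ℤ 1ℤ *ℤ add 1ℤ (_<ᵇ x) (λ κ → σ (x ∷ κ) *ℤ f (x ∷ κ)) xs
    ≡⟨ cong₂ (λ a b → ⟦ p x ⟧ *ℤ (s xs *ℤ (a *ℤ f₀)) +ℤ 1ℤ *ℤ b) (σ-∷ (suc x) xs) rest ⟩
  ⟦ p x ⟧ *ℤ (s xs *ℤ (s xs *ℤ σ xs *ℤ f₀)) +ℤ 1ℤ *ℤ (σ xs *ℤ - (s xs *ℤ d))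
    ≡⟨ lem ⟦ p x ⟧ (s xs) (σ xs) f₀ d ⟩
  s xs *ℤ σ xs *ℤ (⟦ p x ⟧ *ℤ (s xs *ℤ f₀) +ℤ -1ℤ *ℤ d)
    ≡⟨ cong (_*ℤ (⟦ p x ⟧ *ℤ (s xs *ℤ f₀) +ℤ -1ℤ *ℤ d)) (σ-∷ x xs) ⟨
  σ (x ∷ xs) *ℤ (⟦ p x ⟧ *ℤ (s xs *ℤ f₀) +ℤ -1ℤ *ℤ d) ∎
  where
  f₀ = f (suc x ∷ xs)
  d = add -1ℤ (_<ᵇ x) (f ∘ (x ∷_)) xs
  regroup : ∀ a b c → a *ℤ b *ℤ c ≡ b *ℤ (a *ℤ c)
  regroup = solve-∀
  rest : add 1ℤ (_<ᵇ x) (λ κ → σ (x ∷ κ) *ℤ f (x ∷ κ)) xs ≡ σ xs *ℤ - (s xs *ℤ d)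
  rest = begin
    add 1ℤ (_<ᵇ x) (λ κ → σ (x ∷ κ) *ℤ f (x ∷ κ)) xs
      ≡⟨ add-cong 1ℤ (_<ᵇ x) xs P (λ κ _ _ _ →
           trans (cong (_*ℤ f (x ∷ κ)) (σ-∷ x κ)) (regroup (s κ) (σ κ) (f (x ∷ κ)))) ⟩
    add 1ℤ (_<ᵇ x) (λ κ → σ κ *ℤ (s κ *ℤ f (x ∷ κ))) xs
      ≡⟨ add-σ (_<ᵇ x) (λ κ → s κ *ℤ f (x ∷ κ)) xs P ⟩
    σ xs *ℤ add -1ℤ (_<ᵇ x) (λ κ → s κ *ℤ f (x ∷ κ)) xs
      ≡⟨ cong (σ xs *ℤ_) (add-s -1ℤ (_<ᵇ x) (f ∘ (x ∷_)) xs P) ⟩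
    σ xs *ℤ - (s xs *ℤ d) ∎
  lem : ∀ a s t f d → a *ℤ (s *ℤ (s *ℤ t *ℤ f)) +ℤ 1ℤ *ℤ (t *ℤ - (s *ℤ d))
      ≡ s *ℤ t *ℤ (a *ℤ (s *ℤ f) +ℤ -1ℤ *ℤ d)
  lem = solve-∀

-- `fold` exposes the last cell added on the way from β to ν; adjointness needs the first one. The
-- induction can move it to the front because `U` acts on ν and `add` on β.
U^-δ-suc : ∀ n ν β → Part ν → Part β →
           U^ (suc n) (δ β) ν ≡ add 1ℤ (const true) (λ η → U^ n (δ η) ν) β
U^-δ-suc zero ν β P Q = trans (U-δ (const true) ν β P Q λ _ _ → tt)
  (add-cong 1ℤ _ β Q λ κ _ _ _ → cong ⟦_⟧ (eqᵇ-sym ν κ))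
U^-δ-suc (suc n) ν β P Q = trans
  (U-cong ν P λ κ q → U^-δ-suc n κ β (proj₁ q) Q)
  (U-add 1ℤ (const true) (λ κ η → U^ n (δ η) κ) ν β)

-- The plain transpose of `U` is `add 1ℤ`. The factor `σ η` left by the induction hypothesis is what
-- `add-σ` consumes to turn this transpose into `D` and to leave `σ β` outside.
U^-D^-adjoint : ∀ n ν β → Part ν → Part β → U^ n (δ β) ν ≡ σ ν *ℤ σ β *ℤ D^ n (δ ν) β
U^-D^-adjoint zero ν β _ _ = begin
  ⟦ eqᵇ β ν ⟧                        ≡⟨ *-identityʳ _ ⟨
  ⟦ eqᵇ β ν ⟧ *ℤ 1ℤ                  ≡⟨ ⟦⟧-cong (eqᵇ β ν) (λ t → trans (sym (neg1^-square (v ν)))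
                                          (cong (λ z → σ ν *ℤ σ z) (sym (eqᵇ-≡ β ν t)))) ⟩
  ⟦ eqᵇ β ν ⟧ *ℤ (σ ν *ℤ σ β)        ≡⟨ *-comm _ (σ ν *ℤ σ β) ⟩
  σ ν *ℤ σ β *ℤ ⟦ eqᵇ β ν ⟧          ≡⟨ cong (λ b → σ ν *ℤ σ β *ℤ ⟦ b ⟧) (eqᵇ-sym β ν) ⟩
  σ ν *ℤ σ β *ℤ ⟦ eqᵇ ν β ⟧          ∎
U^-D^-adjoint (suc n) ν β P Q = begin
  U^ (suc n) (δ β) ν
    ≡⟨ U^-δ-suc n ν β P Q ⟩
  add 1ℤ (const true) (λ η → U^ n (δ η) ν) β
    ≡⟨ add-cong 1ℤ _ β Q (λ κ R _ _ → trans (U^-D^-adjoint n ν κ P R) (*-assoc (σ ν) (σ κ) _)) ⟩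
  add 1ℤ (const true) (λ η → σ ν *ℤ (σ η *ℤ D^ n (δ ν) η)) β
    ≡⟨ add-* 1ℤ _ (σ ν) _ β ⟩
  σ ν *ℤ add 1ℤ (const true) (λ η → σ η *ℤ D^ n (δ ν) η) β
    ≡⟨ cong (σ ν *ℤ_) (add-σ (const true) (D^ n (δ ν)) β Q) ⟩
  σ ν *ℤ (σ β *ℤ D^ (suc n) (δ ν) β)
    ≡⟨ *-assoc (σ ν) (σ β) _ ⟨
  σ ν *ℤ σ β *ℤ D^ (suc n) (δ ν) β ∎

-- Signed counts of fillings

private variable
  X Y : Set

∑ : List X → (X → ℤ) → ℤ
∑ xs f = sumℤ (map f xs)

∑-cong : ∀ {P : X → Set} {f g : X → ℤ} {xs} → All P xs → (∀ x → P x → f x ≡ g x) → ∑ xs f ≡ ∑ xs g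
∑-cong [] e = refl
∑-cong (p ∷ ps) e = cong₂ _+ℤ_ (e _ p) (∑-cong ps e)

∑-ext : ∀ {f g : X → ℤ} xs → (∀ x → f x ≡ g x) → ∑ xs f ≡ ∑ xs g
∑-ext xs e = ∑-cong (All.universal (λ _ → tt) xs) (λ x _ → e x)

∑-++ : ∀ (xs ys : List X) f → ∑ (xs ++ ys) f ≡ ∑ xs f +ℤ ∑ ys f
∑-++ [] ys f = sym (+ℤ-identityˡ _)
∑-++ (x ∷ xs) ys f = trans (cong (f x +ℤ_) (∑-++ xs ys f)) (sym (+ℤ-assoc (f x) _ _))

∑-map : ∀ (h : X → Y) xs f → ∑ (map h xs) f ≡ ∑ xs (f ∘ h)
∑-map h [] f = refl
∑-map h (x ∷ xs) f = cong (f (h x) +ℤ_) (∑-map h xs f)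

∑-concatMap : ∀ (h : X → List Y) xs f → ∑ (concatMap h xs) f ≡ ∑ xs (λ x → ∑ (h x) f)
∑-concatMap h [] f = refl
∑-concatMap h (x ∷ xs) f = trans (∑-++ (h x) (concatMap h xs) f) (cong (∑ (h x) f +ℤ_) (∑-concatMap h xs f))

∑-+ : ∀ (xs : List X) f g → ∑ xs (λ x → f x +ℤ g x) ≡ ∑ xs f +ℤ ∑ xs g
∑-+ [] f g = refl
∑-+ (x ∷ xs) f g = trans (cong (f x +ℤ g x +ℤ_) (∑-+ xs f g)) (lem (f x) (g x) (∑ xs f) (∑ xs g))
  where
  lem : ∀ a b c d → a +ℤ b +ℤ (c +ℤ d) ≡ a +ℤ c +ℤ (b +ℤ d)
  lem = solve-∀

∑-* : ∀ c (xs : List X) f → ∑ xs (λ x → c *ℤ f x) ≡ c *ℤ ∑ xs f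
∑-* c [] f = sym (*-zeroʳ c)
∑-* c (x ∷ xs) f = trans (cong (c *ℤ f x +ℤ_) (∑-* c xs f)) (lem c (f x) (∑ xs f))
  where
  lem : ∀ c a b → c *ℤ a +ℤ c *ℤ b ≡ c *ℤ (a +ℤ b)
  lem = solve-∀

∑-filter : ∀ (p : X → Bool) xs f → ∑ (filter (λ x → T? (p x)) xs) f ≡ ∑ xs (λ x → ⟦ p x ⟧ *ℤ f x)
∑-filter p [] f = refl
∑-filter p (x ∷ xs) f with p x
... | true = cong₂ _+ℤ_ (sym (*-identityˡ (f x))) (∑-filter p xs f)
... | false = trans (∑-filter p xs f) (sym (+ℤ-identityˡ _))

∏ : List X → (X → ℤ) → ℤ
∏ [] f = 1ℤ
∏ (x ∷ xs) f = f x *ℤ ∏ xs f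

∏-cong : ∀ {P : X → Set} {f g : X → ℤ} {xs} → All P xs → (∀ x → P x → f x ≡ g x) → ∏ xs f ≡ ∏ xs g
∏-cong [] e = refl
∏-cong (p ∷ ps) e = cong₂ _*ℤ_ (e _ p) (∏-cong ps e)

∏-ext : ∀ {f g : X → ℤ} xs → (∀ x → f x ≡ g x) → ∏ xs f ≡ ∏ xs g
∏-ext xs e = ∏-cong (All.universal (λ _ → tt) xs) (λ x _ → e x)

∏-++ : ∀ (xs ys : List X) f → ∏ (xs ++ ys) f ≡ ∏ xs f *ℤ ∏ ys f
∏-++ [] ys f = sym (*-identityˡ _)
∏-++ (x ∷ xs) ys f = trans (cong (f x *ℤ_) (∏-++ xs ys f)) (sym (*-assoc (f x) _ _))

∏-map : ∀ (h : X → Y) xs f → ∏ (map h xs) f ≡ ∏ xs (f ∘ h)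
∏-map h [] f = refl
∏-map h (x ∷ xs) f = cong (f (h x) *ℤ_) (∏-map h xs f)

∏-concatMap : ∀ (h : X → List Y) xs f → ∏ (concatMap h xs) f ≡ ∏ xs (λ x → ∏ (h x) f)
∏-concatMap h [] f = refl
∏-concatMap h (x ∷ xs) f = trans (∏-++ (h x) (concatMap h xs) f) (cong (∏ (h x) f *ℤ_) (∏-concatMap h xs f))

∏-* : ∀ (xs : List X) f g → ∏ xs (λ x → f x *ℤ g x) ≡ ∏ xs f *ℤ ∏ xs g
∏-* [] f g = refl
∏-* (x ∷ xs) f g = trans (cong (f x *ℤ g x *ℤ_) (∏-* xs f g)) (lem (f x) (g x) (∏ xs f) (∏ xs g))
  where
  lem : ∀ a b c d → a *ℤ b *ℤ (c *ℤ d) ≡ a *ℤ c *ℤ (b *ℤ d)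
  lem = solve-∀

∏-one : ∀ {f : X → ℤ} {xs} → All (λ x → f x ≡ 1ℤ) xs → ∏ xs f ≡ 1ℤ
∏-one [] = refl
∏-one (p ∷ ps) = cong₂ _*ℤ_ p (∏-one ps)

∏-↭ : ∀ (f : X → ℤ) {xs ys} → xs ↭ ys → ∏ xs f ≡ ∏ ys f
∏-↭ f refl = refl
∏-↭ f (prep x p) = cong (f x *ℤ_) (∏-↭ f p)
∏-↭ f (swap x y p) = trans (cong (λ z → f x *ℤ (f y *ℤ z)) (∏-↭ f p)) (lem (f x) (f y) _)
  where
  lem : ∀ a b c → a *ℤ (b *ℤ c) ≡ b *ℤ (a *ℤ c)
  lem = solve-∀
∏-↭ f (↭trans p q) = trans (∏-↭ f p) (∏-↭ f q)

∏-pairs : ∀ (xs : List X) f → ∏ (pairs xs) f ≡ ∏ xs (λ a → ∏ xs (λ b → f (a , b)))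
∏-pairs xs f = trans (∏-concatMap _ xs f) (∏-ext xs λ a → ∏-map (a ,_) xs f)

-- `perms` inserts the head of its list last, whereas the recursion on tableaux removes the largest
-- entry, which stands at the end. Commuting insertions brings that entry into the outermost
-- position.
∑-insertions-comm : ∀ x y w (f : List ℕ → ℤ) →
  ∑ (insertions y w) (λ u → ∑ (insertions x u) f) ≡ ∑ (insertions x w) (λ u → ∑ (insertions y u) f)
∑-insertions-comm x y [] f = lem (f (x ∷ y ∷ [])) (f (y ∷ x ∷ []))
  where
  lem : ∀ a b → a +ℤ (b +ℤ 0ℤ) +ℤ 0ℤ ≡ b +ℤ (a +ℤ 0ℤ) +ℤ 0ℤ
  lem = solve-∀
∑-insertions-comm x y (z ∷ w) f = begin
  ∑ (insertions y (z ∷ w)) (λ u → ∑ (insertions x u) f)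
    ≡⟨ expand x y ⟩
  f (x ∷ y ∷ z ∷ w) +ℤ f (y ∷ x ∷ z ∷ w) +ℤ (front y x +ℤ front x y)
    +ℤ ∑ (insertions y w) (λ u → ∑ (insertions x u) (f ∘ (z ∷_)))
    ≡⟨ cong₂ _+ℤ_ (lem (f (x ∷ y ∷ z ∷ w)) (f (y ∷ x ∷ z ∷ w)) (front y x) (front x y))
                  (∑-insertions-comm x y w (f ∘ (z ∷_))) ⟩
  f (y ∷ x ∷ z ∷ w) +ℤ f (x ∷ y ∷ z ∷ w) +ℤ (front x y +ℤ front y x)
    +ℤ ∑ (insertions x w) (λ u → ∑ (insertions y u) (f ∘ (z ∷_)))
    ≡⟨ expand y x ⟨
  ∑ (insertions x (z ∷ w)) (λ u → ∑ (insertions y u) f) ∎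
  where
  -- The words are sorted by how many of the two letters precede z; `front a b` collects those with
  -- a before z and b after it.
  front : ℕ → ℕ → ℤ
  front a b = ∑ (insertions b w) (λ u → f (a ∷ z ∷ u))
  lem : ∀ a b c d → a +ℤ b +ℤ (c +ℤ d) ≡ b +ℤ a +ℤ (d +ℤ c)
  lem = solve-∀
  regroup : ∀ a b c d e → a +ℤ (b +ℤ c) +ℤ (d +ℤ e) ≡ a +ℤ b +ℤ (c +ℤ d) +ℤ e
  regroup = solve-∀
  expand : ∀ x y → ∑ (insertions y (z ∷ w)) (λ u → ∑ (insertions x u) f)
    ≡ f (x ∷ y ∷ z ∷ w) +ℤ f (y ∷ x ∷ z ∷ w) +ℤ (front y x +ℤ front x y)
      +ℤ ∑ (insertions y w) (λ u → ∑ (insertions x u) (f ∘ (z ∷_)))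
  expand x y = begin
    f (x ∷ y ∷ z ∷ w) +ℤ ∑ (map (y ∷_) (insertions x (z ∷ w))) f
      +ℤ ∑ (map (z ∷_) (insertions y w)) (λ u → ∑ (insertions x u) f)
      ≡⟨ cong₂ (λ a b → f (x ∷ y ∷ z ∷ w) +ℤ a +ℤ b)
           (trans (∑-map (y ∷_) (insertions x (z ∷ w)) f)
                  (cong (f (y ∷ x ∷ z ∷ w) +ℤ_) (∑-map (z ∷_) (insertions x w) (f ∘ (y ∷_)))))
           (trans (∑-map (z ∷_) (insertions y w) _)
             (trans (∑-ext (insertions y w) λ u → cong (f (x ∷ z ∷ u) +ℤ_) (∑-map (z ∷_) (insertions x u) f))
                    (∑-+ (insertions y w) _ _))) ⟩
    f (x ∷ y ∷ z ∷ w) +ℤ (f (y ∷ x ∷ z ∷ w) +ℤ front y x)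
      +ℤ (front x y +ℤ ∑ (insertions y w) (λ u → ∑ (insertions x u) (f ∘ (z ∷_))))
      ≡⟨ regroup (f (x ∷ y ∷ z ∷ w)) (f (y ∷ x ∷ z ∷ w)) (front y x) (front x y) _ ⟩
    f (x ∷ y ∷ z ∷ w) +ℤ f (y ∷ x ∷ z ∷ w) +ℤ (front y x +ℤ front x y)
      +ℤ ∑ (insertions y w) (λ u → ∑ (insertions x u) (f ∘ (z ∷_))) ∎

∑-perms-∷ʳ : ∀ xs N f → ∑ (perms (xs ++ [ N ])) f ≡ ∑ (perms xs) (λ w → ∑ (insertions N w) f)
∑-perms-∷ʳ [] N f = ∑-concatMap (insertions N) ([] ∷ []) f
∑-perms-∷ʳ (x ∷ xs) N f = begin
  ∑ (concatMap (insertions x) (perms (xs ++ [ N ]))) f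
    ≡⟨ ∑-concatMap (insertions x) (perms (xs ++ [ N ])) f ⟩
  ∑ (perms (xs ++ [ N ])) (λ w → ∑ (insertions x w) f)
    ≡⟨ ∑-perms-∷ʳ xs N _ ⟩
  ∑ (perms xs) (λ w → ∑ (insertions N w) (λ u → ∑ (insertions x u) f))
    ≡⟨ ∑-ext (perms xs) (λ w → ∑-insertions-comm x N w f) ⟩
  ∑ (perms xs) (λ w → ∑ (insertions x w) (λ u → ∑ (insertions N u) f))
    ≡⟨ ∑-concatMap (insertions x) (perms xs) _ ⟨
  ∑ (perms (x ∷ xs)) (λ w → ∑ (insertions N w) f) ∎

module _ {Q : ℕ → Set} where
  insertions-All : ∀ {x w} → Q x → All Q w → All (λ u → All Q u × length u ≡ suc (length w)) (insertions x w)
  insertions-All q [] = (q ∷ [] , refl) ∷ []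
  insertions-All q (p ∷ ps) = (q ∷ p ∷ ps , refl) ∷
    Allₚ.map⁺ (All.map (λ (a , e) → p ∷ a , cong suc e) (insertions-All q ps))

  perms-All : ∀ {xs} → All Q xs → All (λ w → All Q w × length w ≡ length xs) (perms xs)
  perms-All [] = ([] , refl) ∷ []
  perms-All (q ∷ qs) = Allₚ.concat⁺ (Allₚ.map⁺
    (All.map (λ (a , e) → All.map (λ (b , e′) → b , trans e′ (cong suc e)) (insertions-All q a)) (perms-All qs)))

-- Used to choose the cell of the largest entry. The other cells keep their order, so that a filling
-- of them is again a `zipF`.
∑picks : List X → (X → List X → ℤ) → ℤ
∑picks [] F = 0ℤ
∑picks (c ∷ cs) F = F c cs +ℤ ∑picks cs (λ d ds → F d (c ∷ ds))

∑picks-cong : ∀ {F G : X → List X → ℤ} cs → (∀ c ds → cs ↭ (c ∷ ds) → F c ds ≡ G c ds) → ∑picks cs F ≡ ∑picks cs G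
∑picks-cong [] e = refl
∑picks-cong (c ∷ cs) e = cong₂ _+ℤ_ (e c cs refl)
  (∑picks-cong cs λ d ds p → e d (c ∷ ds) (↭trans (prep c p) (swap c d refl)))

∑picks-* : ∀ k (cs : List X) F → ∑picks cs (λ c ds → k *ℤ F c ds) ≡ k *ℤ ∑picks cs F
∑picks-* k [] F = sym (*-zeroʳ k)
∑picks-* k (c ∷ cs) F = trans (cong (k *ℤ F c cs +ℤ_) (∑picks-* k cs _)) (lem k (F c cs) _)
  where
  lem : ∀ c a b → c *ℤ a +ℤ c *ℤ b ≡ c *ℤ (a +ℤ b)
  lem = solve-∀

∑picks-zero : ∀ {F : X → List X → ℤ} cs → (∀ c ds → cs ↭ (c ∷ ds) → F c ds ≡ 0ℤ) → ∑picks cs F ≡ 0ℤ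
∑picks-zero {F = F} cs e = trans (∑picks-cong {G = λ _ _ → 0ℤ *ℤ 0ℤ} cs e) (∑picks-* 0ℤ cs (λ _ _ → 0ℤ))

∑picks-++ : ∀ (as bs : List X) F → ∑picks (as ++ bs) F
          ≡ ∑picks as (λ c ds → F c (ds ++ bs)) +ℤ ∑picks bs (λ c ds → F c (as ++ ds))
∑picks-++ [] bs F = sym (+ℤ-identityˡ _)
∑picks-++ (a ∷ as) bs F = trans (cong (F a (as ++ bs) +ℤ_) (∑picks-++ as bs _)) (sym (+ℤ-assoc (F a (as ++ bs)) _ _))

∑-∑picks : ∀ (xs : List Y) (cs : List X) (F : Y → X → List X → ℤ) →
           ∑ xs (λ w → ∑picks cs (F w)) ≡ ∑picks cs (λ c ds → ∑ xs (λ w → F w c ds))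
∑-∑picks xs [] F = ∑-* 0ℤ xs (const 0ℤ)
∑-∑picks xs (c ∷ cs) F = trans (∑-+ xs _ _) (cong (∑ xs (λ w → F w c cs) +ℤ_) (∑-∑picks xs cs _))

-- The position at which N enters the word determines the cell that receives it. Invariance of `F`
-- under reordering is needed to bring that entry to the front of the filling.
∑-insertions-zipF : ∀ N cs w (F : Filling → ℤ) → (∀ {S T} → S ↭ T → F S ≡ F T) → length cs ≡ suc (length w) →
  ∑ (insertions N w) (F ∘ zipF cs) ≡ ∑picks cs (λ c ds → F ((c , N) ∷ zipF ds w))
∑-insertions-zipF N (c ∷ []) [] F _ _ = refl
∑-insertions-zipF N (c ∷ cs) (y ∷ w) F resp e = cong (F ((c , N) ∷ zipF cs (y ∷ w)) +ℤ_) (begin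
  ∑ (map (y ∷_) (insertions N w)) (F ∘ zipF (c ∷ cs))
    ≡⟨ ∑-map (y ∷_) (insertions N w) _ ⟩
  ∑ (insertions N w) ((F ∘ ((c , y) ∷_)) ∘ zipF cs)
    ≡⟨ ∑-insertions-zipF N cs w (F ∘ ((c , y) ∷_)) (λ p → resp (prep (c , y) p)) (suc-injective e) ⟩
  ∑picks cs (λ d ds → F ((c , y) ∷ (d , N) ∷ zipF ds w))
    ≡⟨ ∑picks-cong cs (λ d ds _ → resp (swap (c , y) (d , N) refl)) ⟩
  ∑picks cs (λ d ds → F ((d , N) ∷ (c , y) ∷ zipF ds w)) ∎)

-- Monotonicity and sign as products over pairs of entries

bit : Bool → ℤ
bit b = neg1^ (if b then 1 else 0)

⟦allᵇ⟧ : ∀ p (xs : List X) → ⟦ allᵇ p xs ⟧ ≡ ∏ xs (λ x → ⟦ p x ⟧)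
⟦allᵇ⟧ p [] = refl
⟦allᵇ⟧ p (x ∷ xs) = trans (⟦⟧-∧ (p x) (allᵇ p xs)) (cong (⟦ p x ⟧ *ℤ_) (⟦allᵇ⟧ p xs))

neg1^-countᵇ : ∀ p (xs : List X) → neg1^ (countᵇ p xs) ≡ ∏ xs (λ x → bit (p x))
neg1^-countᵇ p [] = refl
neg1^-countᵇ p (x ∷ xs) = trans (neg1^-+ (if p x then 1 else 0) _) (cong (bit (p x) *ℤ_) (neg1^-countᵇ p xs))

Entry : Set
Entry = Cell × ℕ

orderedᵇ invertedᵇ : Entry → Entry → Bool
orderedᵇ (a , x) (b , y) = if ≤cᵇ a b then x ≤ᵇ y else true
invertedᵇ (a , x) (b , y) = ◁ᵇ a b ∧ (y <ᵇ x)

⟦monotone⟧ : ∀ T → ⟦ monotoneᵇ T ⟧ ≡ ∏ T (λ p → ∏ T (λ q → ⟦ orderedᵇ p q ⟧))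
⟦monotone⟧ T = trans (⟦allᵇ⟧ _ (pairs T)) (∏-pairs T _)

signStraight-∏ : ∀ T → signStraight T ≡ ∏ T (λ p → ∏ T (λ q → bit (invertedᵇ p q)))
signStraight-∏ T = trans (neg1^-countᵇ _ (pairs T)) (∏-pairs T _)

ω : Entry → Entry → ℤ
ω p q = ⟦ orderedᵇ p q ⟧ *ℤ bit (invertedᵇ p q)

-- The sign of a monotone filling, and 0 for any other filling, so sums may run over all
-- permutations. Being a product over all ordered pairs, it ignores the order in which the entries
-- are listed.
weight : Filling → ℤ
weight T = ∏ T (λ p → ∏ T (ω p))

weight-signed : ∀ T → ⟦ monotoneᵇ T ⟧ *ℤ signStraight T ≡ weight T
weight-signed T = begin
  ⟦ monotoneᵇ T ⟧ *ℤ signStraight T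
    ≡⟨ cong₂ _*ℤ_ (⟦monotone⟧ T) (signStraight-∏ T) ⟩
  ∏ T (λ p → ∏ T (λ q → ⟦ orderedᵇ p q ⟧)) *ℤ ∏ T (λ p → ∏ T (λ q → bit (invertedᵇ p q)))
    ≡⟨ ∏-* T _ _ ⟨
  ∏ T (λ p → ∏ T (λ q → ⟦ orderedᵇ p q ⟧) *ℤ ∏ T (λ q → bit (invertedᵇ p q)))
    ≡⟨ ∏-ext T (λ p → ∏-* T _ _) ⟨
  weight T ∎

weight-↭ : ∀ {S T} → S ↭ T → weight S ≡ weight T
weight-↭ {S} {T} p = trans (∏-ext S λ e → ∏-↭ (ω e) p) (∏-↭ (λ e → ∏ T (ω e)) p)

-- ρ c b is what the pair of cells c, b contributes to a weight when c holds the larger entry.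
κ ρ : Cell → Cell → ℤ
κ c b = bit (◁ᵇ c b)
ρ c b = ⟦ not (≤cᵇ c b) ⟧ *ℤ κ c b

¬T-false : ∀ {b} → ¬ T b → b ≡ false
¬T-false {true} n = ⊥-elim (n tt)
¬T-false {false} _ = refl

T-true : ∀ {b} → T b → b ≡ true
T-true {true} _ = refl

if-same : ∀ b → (if b then true else true) ≡ true
if-same true = refl
if-same false = refl

if-not : ∀ b → (if b then false else true) ≡ not b
if-not true = refl
if-not false = refl

<ᵇ-false : ∀ {x y} → y ≤ x → (x <ᵇ y) ≡ false
<ᵇ-false {x} {y} le = ¬T-false λ t → <⇒≱ (<ᵇ⇒< x y t) le

≤ᵇ-false : ∀ {x y} → y < x → (x ≤ᵇ y) ≡ false
≤ᵇ-false {x} {y} lt = ¬T-false λ t → <⇒≱ lt (≤ᵇ⇒≤ x y t)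

ω-fromMax : ∀ c b {N y} → y < N → ω (c , N) (b , y) ≡ ρ c b
ω-fromMax c b lt rewrite ≤ᵇ-false lt | T-true (<⇒<ᵇ lt) | if-not (≤cᵇ c b) | ∧-identityʳ (◁ᵇ c b) = refl

ω-toMax : ∀ c b {N y} → y ≤ N → ω (b , y) (c , N) ≡ 1ℤ
ω-toMax c b {N} {y} le rewrite T-true (≤⇒≤ᵇ le) | <ᵇ-false le | if-same (≤cᵇ b c) | ∧-zeroʳ (◁ᵇ b c) = refl

-- A pair that ends at the largest entry, including its pair with itself, is ordered and not
-- inverted, so it contributes 1. Only the pairs that start there leave a factor.
weight-max : ∀ c N T → All (λ e → proj₂ e < N) T →
             weight ((c , N) ∷ T) ≡ ∏ T (λ e → ρ c (proj₁ e)) *ℤ weight T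
weight-max c N T lt = begin
  ω t t *ℤ ∏ T (ω t) *ℤ ∏ T (λ e → ω e t *ℤ ∏ T (ω e))
    ≡⟨ cong (ω t t *ℤ ∏ T (ω t) *ℤ_) (∏-* T _ _) ⟩
  ω t t *ℤ ∏ T (ω t) *ℤ (∏ T (λ e → ω e t) *ℤ weight T)
    ≡⟨ cong₂ (λ a b → a *ℤ ∏ T (ω t) *ℤ (b *ℤ weight T)) (ω-toMax c c {N} ≤-refl)
         (∏-one (All.map (λ {e} q → ω-toMax c (proj₁ e) (<⇒≤ q)) lt)) ⟩
  1ℤ *ℤ ∏ T (ω t) *ℤ (1ℤ *ℤ weight T)
    ≡⟨ cong (λ a → 1ℤ *ℤ a *ℤ (1ℤ *ℤ weight T)) (∏-cong lt λ e → ω-fromMax c (proj₁ e)) ⟩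
  1ℤ *ℤ ∏ T (λ e → ρ c (proj₁ e)) *ℤ (1ℤ *ℤ weight T)
    ≡⟨ cong₂ _*ℤ_ (*-identityˡ (∏ T (λ e → ρ c (proj₁ e)))) (*-identityˡ (weight T)) ⟩
  ∏ T (λ e → ρ c (proj₁ e)) *ℤ weight T ∎
  where
  t = (c , N)

zipF-All : ∀ {Q : ℕ → Set} cs {w} → All Q w → All (λ e → Q (proj₂ e)) (zipF cs w)
zipF-All [] _ = []
zipF-All (c ∷ cs) [] = []
zipF-All (c ∷ cs) (q ∷ qs) = q ∷ zipF-All cs qs

∏-zipF : ∀ cs w (f : Cell → ℤ) → length w ≡ length cs → ∏ (zipF cs w) (λ e → f (proj₁ e)) ≡ ∏ cs f
∏-zipF [] [] f _ = refl
∏-zipF (c ∷ cs) (x ∷ w) f e = cong (f c *ℤ_) (∏-zipF cs w f (suc-injective e))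

length-zipF : ∀ cs w → length w ≡ length cs → length (zipF cs w) ≡ length cs
length-zipF [] [] _ = refl
length-zipF (c ∷ cs) (x ∷ w) e = cong suc (length-zipF cs w (suc-injective e))

oneTo-suc : ∀ n → oneTo (suc n) ≡ oneTo n ++ [ suc n ]
oneTo-suc n = trans (cong (map suc) (sym (upTo-∷ʳ n))) (map-++ suc (upTo n) [ n ])

length-oneTo : ∀ n → length (oneTo n) ≡ n
length-oneTo n = trans (length-map suc (upTo n)) (length-upTo n)

oneTo-All : ∀ n → All (λ x → 1 ≤ x × x ≤ n) (oneTo n)
oneTo-All n = Allₚ.map⁺ (Allₚ.applyUpTo⁺₁ (λ x → x) n λ i<n → s≤s z≤n , i<n)

J : List Cell → ℤ
J cs = ∑ (perms (oneTo (length cs))) (weight ∘ zipF cs)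

J-step : ∀ cs n → length cs ≡ suc n → J cs ≡ ∑picks cs (λ c ds → ∏ ds (ρ c) *ℤ J ds)
J-step cs n eq = begin
  ∑ (perms (oneTo (length cs))) (weight ∘ zipF cs)
    ≡⟨ cong (λ l → ∑ (perms l) (weight ∘ zipF cs)) (trans (cong oneTo eq) (oneTo-suc n)) ⟩
  ∑ (perms (oneTo n ++ [ suc n ])) (weight ∘ zipF cs)
    ≡⟨ ∑-perms-∷ʳ (oneTo n) (suc n) _ ⟩
  ∑ (perms (oneTo n)) (λ w → ∑ (insertions (suc n) w) (weight ∘ zipF cs))
    ≡⟨ ∑-cong (perms-All (oneTo-All n)) pick ⟩
  ∑ (perms (oneTo n)) (λ w → ∑picks cs (λ c ds → ∏ ds (ρ c) *ℤ weight (zipF ds w)))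
    ≡⟨ ∑-∑picks (perms (oneTo n)) cs _ ⟩
  ∑picks cs (λ c ds → ∑ (perms (oneTo n)) (λ w → ∏ ds (ρ c) *ℤ weight (zipF ds w)))
    ≡⟨ ∑picks-cong cs (λ c ds p → trans (∑-* (∏ ds (ρ c)) (perms (oneTo n)) _)
         (cong (λ k → ∏ ds (ρ c) *ℤ ∑ (perms (oneTo k)) (weight ∘ zipF ds)) (rest p))) ⟩
  ∑picks cs (λ c ds → ∏ ds (ρ c) *ℤ J ds) ∎
  where
  rest : ∀ {c ds} → cs ↭ (c ∷ ds) → n ≡ length ds
  rest p = suc-injective (trans (sym eq) (↭-length p))
  pick : ∀ w → All (λ x → 1 ≤ x × x ≤ n) w × length w ≡ length (oneTo n) →
    ∑ (insertions (suc n) w) (weight ∘ zipF cs) ≡ ∑picks cs (λ c ds → ∏ ds (ρ c) *ℤ weight (zipF ds w))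
  pick w (bounds , len) = trans
    (∑-insertions-zipF (suc n) cs w weight weight-↭ (trans eq (cong suc (sym len′))))
    (∑picks-cong cs λ c ds p → trans
      (weight-max c (suc n) (zipF ds w) (zipF-All ds (All.map (λ (_ , q) → s≤s q) bounds)))
      (cong (_*ℤ weight (zipF ds w)) (∏-zipF ds w (ρ c) (trans len′ (rest p)))))
    where
    len′ = trans len (length-oneTo n)

-- In `T₀ μ ⋄ T` a cell of `T` holds a larger entry than every cell of μ, so it is inverted with
-- precisely the cells of μ that follow it in reading order.
crossing : List ℕ → Cell → ℤ
crossing μ b = ∏ (cells μ) (κ b)

<ᵇ-+ʳ : ∀ x y k → (x + k <ᵇ y + k) ≡ (x <ᵇ y)
<ᵇ-+ʳ x y k with x <ᵇ y in eq
... | true = T-true (<⇒<ᵇ (+-monoˡ-< k (<ᵇ⇒< x y (subst T (sym eq) tt))))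
... | false = ¬T-false λ t → subst T eq (<⇒<ᵇ (+-cancelʳ-< k x y (<ᵇ⇒< (x + k) (y + k) t)))

-- The inversions inside T₀ are counted twice, and none goes from T₀ to T.
signSkew-∏ : ∀ μ cs w → length w ≡ length cs → All (1 ≤_) w →
             signSkew μ (zipF cs w) ≡ ∏ cs (crossing μ) *ℤ signStraight (zipF cs w)
signSkew-∏ μ cs w len pos = begin
  signStraight A *ℤ signStraight (A ⋄ S)
    ≡⟨ cong₂ _*ℤ_ (signStraight-∏ A) (signStraight-∏ (A ⋄ S)) ⟩
  ∏ A (λ p → ∏ A (τ p)) *ℤ ∏ (A ++ B) (λ p → ∏ (A ++ B) (τ p))
    ≡⟨ cong (∏ A (λ p → ∏ A (τ p)) *ℤ_) (trans (∏-ext (A ++ B) λ p → ∏-++ A B (τ p))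
         (trans (∏-* (A ++ B) _ _) (cong₂ _*ℤ_ (∏-++ A B _) (∏-++ A B _)))) ⟩
  ∏ A (λ p → ∏ A (τ p)) *ℤ ((∏ A (λ p → ∏ A (τ p)) *ℤ ∏ B (λ p → ∏ A (τ p)))
    *ℤ (∏ A (λ p → ∏ B (τ p)) *ℤ ∏ B (λ p → ∏ B (τ p))))
    ≡⟨ lem (∏ A (λ p → ∏ A (τ p))) (∏ B (λ p → ∏ A (τ p))) (∏ A (λ p → ∏ B (τ p))) (∏ B (λ p → ∏ B (τ p))) ⟩
  (∏ A (λ p → ∏ A (τ p)) *ℤ ∏ A (λ p → ∏ A (τ p)))
    *ℤ (∏ B (λ p → ∏ A (τ p)) *ℤ (∏ A (λ p → ∏ B (τ p)) *ℤ ∏ B (λ p → ∏ B (τ p))))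
    ≡⟨ cong₂ _*ℤ_ (trans (sym (cong₂ _*ℤ_ (signStraight-∏ A) (signStraight-∏ A))) (neg1^-square (inversions A)))
         (cong₂ _*ℤ_ BA (cong₂ _*ℤ_ AB BB)) ⟩
  1ℤ *ℤ (∏ cs (crossing μ) *ℤ (1ℤ *ℤ signStraight S))
    ≡⟨ trans (*-identityˡ _) (cong (∏ cs (crossing μ) *ℤ_) (*-identityˡ _)) ⟩
  ∏ cs (crossing μ) *ℤ signStraight S ∎
  where
  τ : Entry → Entry → ℤ
  τ p q = bit (invertedᵇ p q)
  N = length (cells μ)
  A = T₀ μ
  S = zipF cs w
  k = length A
  k≡N : k ≡ N
  k≡N = length-zipF (cells μ) (oneTo N) (length-oneTo N)
  shift : Entry → Entry
  shift (c , x) = c , x + k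
  B = map shift S
  lem : ∀ a b c d → a *ℤ (a *ℤ b *ℤ (c *ℤ d)) ≡ a *ℤ a *ℤ (b *ℤ (c *ℤ d))
  lem = solve-∀
  A≤ : All (λ e → proj₂ e ≤ k) A
  A≤ = subst (λ n → All (λ e → proj₂ e ≤ n) A) (sym k≡N) (zipF-All (cells μ) (All.map proj₂ (oneTo-All N)))
  S≥ : All (λ e → 1 ≤ proj₂ e) S
  S≥ = zipF-All cs pos
  AB : ∏ A (λ p → ∏ B (τ p)) ≡ 1ℤ
  AB = ∏-one (All.map (λ {(a , x)} x≤k → trans (∏-map shift S (τ (a , x)))
    (∏-one (All.map (λ {(b , y)} 1≤y → trans
      (cong (λ z → bit (◁ᵇ a b ∧ z)) (<ᵇ-false (≤-trans x≤k (≤-trans (n≤1+n k) (+-monoˡ-≤ k 1≤y)))))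
      (cong bit (∧-zeroʳ (◁ᵇ a b)))) S≥))) A≤)
  BA : ∏ B (λ p → ∏ A (τ p)) ≡ ∏ cs (crossing μ)
  BA = begin
    ∏ B (λ p → ∏ A (τ p))
      ≡⟨ ∏-map shift S _ ⟩
    ∏ S (λ p → ∏ A (τ (shift p)))
      ≡⟨ ∏-cong S≥ (λ (b , y) 1≤y → trans
           (∏-cong A≤ (λ (a , x) x≤k → trans
             (cong (λ z → bit (◁ᵇ b a ∧ z)) (T-true (<⇒<ᵇ (≤-trans (s≤s x≤k) (+-monoˡ-≤ k 1≤y)))))
             (cong bit (∧-identityʳ (◁ᵇ b a)))))
           (∏-zipF (cells μ) (oneTo N) (κ b) (length-oneTo N))) ⟩
    ∏ S (λ e → crossing μ (proj₁ e))
      ≡⟨ ∏-zipF cs w (crossing μ) len ⟩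
    ∏ cs (crossing μ) ∎
  BB : ∏ B (λ p → ∏ B (τ p)) ≡ signStraight S
  BB = begin
    ∏ B (λ p → ∏ B (τ p))
      ≡⟨ trans (∏-map shift S _) (∏-ext S λ p → ∏-map shift S _) ⟩
    ∏ S (λ p → ∏ S (λ q → τ (shift p) (shift q)))
      ≡⟨ ∏-ext S (λ (a , x) → ∏-ext S λ (b , y) → cong (λ z → bit (◁ᵇ a b ∧ z)) (<ᵇ-+ʳ y x k)) ⟩
    ∏ S (λ p → ∏ S (τ p))
      ≡⟨ signStraight-∏ S ⟨
    signStraight S ∎

-- `I` with an arbitrary list of cells in place of a skew shape. Removing any cell at all stays
-- within this definition, and cells that are not corners are discarded later.
G : List ℕ → List Cell → ℤ
G μ cs = ∏ cs (crossing μ) *ℤ J cs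

I-G : ∀ ν μ → I ν μ ≡ G μ (skewCells ν μ)
I-G ν μ = begin
  ∑ (SYT ν μ) (signSkew μ)
    ≡⟨ ∑-filter monotoneᵇ (fillingsOf cs) (signSkew μ) ⟩
  ∑ (fillingsOf cs) (λ S → ⟦ monotoneᵇ S ⟧ *ℤ signSkew μ S)
    ≡⟨ ∑-map (zipF cs) words _ ⟩
  ∑ words (λ w → ⟦ monotoneᵇ (zipF cs w) ⟧ *ℤ signSkew μ (zipF cs w))
    ≡⟨ ∑-cong (perms-All (oneTo-All (length cs))) (λ w (bounds , len) →
         trans (cong (⟦ monotoneᵇ (zipF cs w) ⟧ *ℤ_)
                 (signSkew-∏ μ cs w (trans len (length-oneTo (length cs))) (All.map proj₁ bounds)))
           (trans (lem ⟦ monotoneᵇ (zipF cs w) ⟧ χ _) (cong (χ *ℤ_) (weight-signed (zipF cs w))))) ⟩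
  ∑ words (λ w → χ *ℤ weight (zipF cs w))
    ≡⟨ ∑-* χ words _ ⟩
  χ *ℤ J cs ∎
  where
  cs = skewCells ν μ
  words = perms (oneTo (length cs))
  χ = ∏ cs (crossing μ)
  lem : ∀ a b c → a *ℤ (b *ℤ c) ≡ b *ℤ (a *ℤ c)
  lem = solve-∀

G-step : ∀ μ cs n → length cs ≡ suc n →
         G μ cs ≡ ∑picks cs (λ c ds → ∏ ds (ρ c) *ℤ crossing μ c *ℤ G μ ds)
G-step μ cs n eq = begin
  ∏ cs (crossing μ) *ℤ J cs
    ≡⟨ cong (∏ cs (crossing μ) *ℤ_) (J-step cs n eq) ⟩
  ∏ cs (crossing μ) *ℤ ∑picks cs (λ c ds → ∏ ds (ρ c) *ℤ J ds)
    ≡⟨ ∑picks-* (∏ cs (crossing μ)) cs _ ⟨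
  ∑picks cs (λ c ds → ∏ cs (crossing μ) *ℤ (∏ ds (ρ c) *ℤ J ds))
    ≡⟨ ∑picks-cong cs (λ c ds p → trans (cong (_*ℤ (∏ ds (ρ c) *ℤ J ds)) (∏-↭ (crossing μ) p))
         (lem (crossing μ c) (∏ ds (crossing μ)) (∏ ds (ρ c)) (J ds))) ⟩
  ∑picks cs (λ c ds → ∏ ds (ρ c) *ℤ crossing μ c *ℤ G μ ds) ∎
  where
  lem : ∀ a b c d → a *ℤ b *ℤ (c *ℤ d) ≡ c *ℤ a *ℤ (b *ℤ d)
  lem = solve-∀

-- Removing the largest entry of a skew tableau

tl : List ℕ → List ℕ
tl = drop 1

-- Built at the right end of the row because that is where a corner is removed.
seg : ℕ → ℕ → ℕ → List Cell
seg r a zero = []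
seg r a (suc x) = seg r a x ++ (if a ≤ᵇ x then [ (r , x) ] else [])

skewFrom : ℕ → List ℕ → List ℕ → List Cell
skewFrom r [] μ = []
skewFrom r (x ∷ ν) μ = seg r (hd μ) x ++ skewFrom (suc r) ν (tl μ)

rowCells-suc : ∀ r x → rowCells r (suc x) ≡ rowCells r x ++ [ (r , x) ]
rowCells-suc r x = trans (cong (map (r ,_)) (sym (upTo-∷ʳ x))) (map-++ (r ,_) (upTo x) [ x ])

not-<ᵇ : ∀ a x → not (x <ᵇ a) ≡ (a ≤ᵇ x)
not-<ᵇ zero x = refl
not-<ᵇ (suc a) zero = refl
not-<ᵇ (suc zero) (suc x) = refl
not-<ᵇ (suc (suc a)) (suc x) = not-<ᵇ (suc a) x

filter-[] : ∀ {X : Set} (p : X → Bool) x → filter (λ c → T? (p c)) [ x ] ≡ (if p x then [ x ] else [])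
filter-[] p x with p x
... | true = refl
... | false = refl

filter-rowCells : ∀ μ₀ r x → filter (λ c → T? (not (inDiagramᵇ μ₀ c))) (rowCells r x) ≡ seg r (part μ₀ r) x
filter-rowCells μ₀ r zero = refl
filter-rowCells μ₀ r (suc x) = begin
  filter P? (rowCells r (suc x))
    ≡⟨ cong (filter P?) (rowCells-suc r x) ⟩
  filter P? (rowCells r x ++ [ (r , x) ])
    ≡⟨ filter-++ P? (rowCells r x) _ ⟩
  filter P? (rowCells r x) ++ filter P? [ (r , x) ]
    ≡⟨ cong₂ _++_ (filter-rowCells μ₀ r x) (trans (filter-[] (λ c → not (inDiagramᵇ μ₀ c)) (r , x))
         (cong (λ b → if b then [ (r , x) ] else []) (not-<ᵇ (part μ₀ r) x))) ⟩
  seg r (part μ₀ r) (suc x) ∎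
  where
  P? = λ c → T? (not (inDiagramᵇ μ₀ c))

part-0 : ∀ μ → part μ 0 ≡ hd μ
part-0 [] = refl
part-0 (_ ∷ _) = refl

part-suc : ∀ μ i → part μ (suc i) ≡ part (tl μ) i
part-suc [] i = refl
part-suc (_ ∷ _) i = refl

-- The filter tests absolute row numbers against the whole inner shape μ₀, while the recursion only
-- holds μ, its rows from r on; the hypothesis links the two.
filter-cellsFrom : ∀ μ₀ r ν μ → (∀ i → part μ₀ (i + r) ≡ part μ i) →
  filter (λ c → T? (not (inDiagramᵇ μ₀ c))) (cellsFrom r ν) ≡ skewFrom r ν μ
filter-cellsFrom μ₀ r [] μ _ = refl
filter-cellsFrom μ₀ r (x ∷ ν) μ e = trans (filter-++ _ (rowCells r x) _) (cong₂ _++_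
  (trans (filter-rowCells μ₀ r x) (cong (λ a → seg r a x) (trans (e 0) (part-0 μ))))
  (filter-cellsFrom μ₀ (suc r) ν (tl μ) λ i →
    trans (cong (part μ₀) (+-suc i r)) (trans (e (suc i)) (part-suc μ i))))

skewCells-skewFrom : ∀ ν μ → skewCells ν μ ≡ skewFrom 0 ν μ
skewCells-skewFrom ν μ = filter-cellsFrom μ 0 ν μ λ i → cong (part μ) (+-identityʳ i)

seg-All : ∀ r a x → All (λ b → proj₁ b ≡ r × proj₂ b < x) (seg r a x)
seg-All r a zero = []
seg-All r a (suc x) = Allₚ.++⁺ (All.map (λ (e , q) → e , m≤n⇒m≤1+n q) (seg-All r a x)) (last (a ≤ᵇ x))
  where
  last : ∀ b → All (λ b → proj₁ b ≡ r × proj₂ b < suc x) (if b then [ (r , x) ] else [])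
  last true = (refl , ≤-refl) ∷ []
  last false = []

seg-empty : ∀ r a x → x ≤ a → seg r a x ≡ []
seg-empty r a zero _ = refl
seg-empty r a (suc x) x<a = cong₂ _++_ (seg-empty r a x (<⇒≤ x<a))
  (cong (λ b → if b then [ (r , x) ] else []) (≤ᵇ-false x<a))

seg-snoc : ∀ r a x → a ≤ x → seg r a (suc x) ≡ seg r a x ++ [ (r , x) ]
seg-snoc r a x a≤x = cong (λ b → seg r a x ++ (if b then [ (r , x) ] else [])) (T-true (≤⇒≤ᵇ a≤x))

length-seg : ∀ r a x → a ≤ x → length (seg r a x) + a ≡ x
length-seg r a x a≤x with a ≤? pred x
length-seg r zero zero _ | _ = refl
length-seg r a (suc x) _ | yes a≤ = begin
  length (seg r a (suc x)) + a          ≡⟨ cong (λ l → length l + a) (seg-snoc r a x a≤) ⟩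
  length (seg r a x ++ [ (r , x) ]) + a ≡⟨ cong (_+ a) (trans (length-++ (seg r a x)) (+-comm _ 1)) ⟩
  suc (length (seg r a x) + a)          ≡⟨ cong suc (length-seg r a x a≤) ⟩
  suc x ∎
length-seg r a (suc x) a≤x | no a≰ with ≤-antisym a≤x (≰⇒> a≰)
... | refl = cong (λ l → length l + suc x) (seg-empty r (suc x) (suc x) ≤-refl)

hd-tl : ∀ μ → Part μ → hd (tl μ) ≤ hd μ × Part (tl μ)
hd-tl [] _ = z≤n , tt
hd-tl (_ ∷ _) (_ , h≤ , P) = h≤ , P

size-hd-tl : ∀ μ → size μ ≡ hd μ + size (tl μ)
size-hd-tl [] = refl
size-hd-tl (_ ∷ _) = refl

containedᵇ-∷ : ∀ μ x ν → containedᵇ μ (x ∷ ν) ≡ (hd μ ≤ᵇ x) ∧ containedᵇ (tl μ) ν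
containedᵇ-∷ [] x ν = refl
containedᵇ-∷ (_ ∷ _) x ν = refl

contained-split : ∀ μ x ν → T (containedᵇ μ (x ∷ ν)) → hd μ ≤ x × T (containedᵇ (tl μ) ν)
contained-split μ x ν q with ∧-elim {hd μ ≤ᵇ x} (subst T (containedᵇ-∷ μ x ν) q)
... | a , b = ≤ᵇ⇒≤ (hd μ) x a , b

length-skewFrom : ∀ r ν μ → T (containedᵇ μ ν) → length (skewFrom r ν μ) + size μ ≡ size ν
length-skewFrom r [] [] _ = refl
length-skewFrom r (x ∷ ν) μ q with contained-split μ x ν q
... | a≤x , q′ = begin
  length (seg r (hd μ) x ++ skewFrom (suc r) ν (tl μ)) + size μ
    ≡⟨ cong₂ _+_ (length-++ (seg r (hd μ) x)) (size-hd-tl μ) ⟩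
  length (seg r (hd μ) x) + length (skewFrom (suc r) ν (tl μ)) + (hd μ + size (tl μ))
    ≡⟨ interchange ℕₚ.+-commutativeSemigroup (length (seg r (hd μ) x)) (length (skewFrom (suc r) ν (tl μ))) (hd μ) (size (tl μ)) ⟩
  (length (seg r (hd μ) x) + hd μ) + (length (skewFrom (suc r) ν (tl μ)) + size (tl μ))
    ≡⟨ cong₂ _+_ (length-seg r (hd μ) x a≤x) (length-skewFrom (suc r) ν (tl μ) q′) ⟩
  x + size ν ∎

skewFrom-All : ∀ r ν μ → Part ν → All (λ b → r ≤ proj₁ b × proj₂ b < hd ν) (skewFrom r ν μ)
skewFrom-All r [] μ _ = []
skewFrom-All r (x ∷ ν) μ (_ , h≤x , P) = Allₚ.++⁺
  (All.map (λ (e , q) → ≤-reflexive (sym e) , q) (seg-All r (hd μ) x))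
  (All.map (λ (q , q′) → <⇒≤ q , ≤-trans q′ h≤x) (skewFrom-All (suc r) ν (tl μ) P))

≡ᵇ-refl : ∀ n → (n ≡ᵇ n) ≡ true
≡ᵇ-refl n = T-true (≡⇒≡ᵇ n n refl)

≡ᵇ-false : ∀ {m n} → ¬ m ≡ n → (m ≡ᵇ n) ≡ false
≡ᵇ-false {m} {n} ne = ¬T-false λ t → ne (≡ᵇ⇒≡ m n t)

κ-below : ∀ {c b} → proj₁ c < proj₁ b → κ c b ≡ -1ℤ
κ-below lt rewrite T-true (<⇒<ᵇ lt) = refl

κ-above : ∀ {c b} → proj₁ b < proj₁ c → κ c b ≡ 1ℤ
κ-above lt rewrite <ᵇ-false (<⇒≤ lt) | ≡ᵇ-false (λ e → <⇒≢ lt (sym e)) = refl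

κ-left : ∀ {r x j} → j ≤ x → κ (r , x) (r , j) ≡ 1ℤ
κ-left {r} le rewrite <ᵇ-false (≤-refl {r}) | ≡ᵇ-refl r | <ᵇ-false le = refl

-- A cell below and strictly to the left is incomparable with c, so the larger entry at c is
-- permitted, and it follows c in reading order, so the pair is an inversion.
ρ-below : ∀ {c b} → proj₁ c < proj₁ b → proj₂ b < proj₂ c → ρ c b ≡ -1ℤ
ρ-below {c} {b} lt lt′ rewrite ≤ᵇ-false lt′ | ∧-zeroʳ (proj₁ c ≤ᵇ proj₁ b) | κ-below {c} {b} lt = refl

ρ-above : ∀ {c b} → proj₁ b < proj₁ c → ρ c b ≡ 1ℤ
ρ-above {c} {b} lt rewrite ≤ᵇ-false lt | κ-above {c} {b} lt = refl

ρ-left : ∀ {r x j} → j < x → ρ (r , x) (r , j) ≡ 1ℤ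
ρ-left {r} {x} {j} lt rewrite ≤ᵇ-false lt | ∧-zeroʳ (r ≤ᵇ r) | κ-left {r} (<⇒≤ lt) = refl

-- Monotonicity forbids a larger entry at c than at a cell weakly below and to the right of it.
ρ-dominated : ∀ {c b} → proj₁ c ≤ proj₁ b → proj₂ c ≤ proj₂ b → ρ c b ≡ 0ℤ
ρ-dominated le le′ rewrite T-true (≤⇒≤ᵇ le) | T-true (≤⇒≤ᵇ le′) = refl

∏-minus : ∀ {X : Set} {f : X → ℤ} {xs} → All (λ x → f x ≡ -1ℤ) xs → ∏ xs f ≡ neg1^ (length xs)
∏-minus [] = refl
∏-minus {f = f} {x ∷ xs} (p ∷ ps) = trans (cong₂ _*ℤ_ p (∏-minus ps)) (-1*i≡-i (neg1^ (length xs)))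

∏-zero : ∀ {X : Set} (f : X → ℤ) as x bs → f x ≡ 0ℤ → ∏ (as ++ x ∷ bs) f ≡ 0ℤ
∏-zero f as x bs e = trans (∏-++ as (x ∷ bs) f)
  (trans (cong (λ z → ∏ as f *ℤ (z *ℤ ∏ bs f)) e) (*-zeroʳ (∏ as f)))

length-cellsFrom : ∀ r μ → length (cellsFrom r μ) ≡ size μ
length-cellsFrom r [] = refl
length-cellsFrom r (x ∷ μ) = trans (length-++ (rowCells r x))
  (cong₂ _+_ (trans (length-map (r ,_) (upTo x)) (length-upTo x)) (length-cellsFrom (suc r) μ))

rowCells-All : ∀ r x → All (λ b → proj₁ b ≡ r × proj₂ b < x) (rowCells r x)
rowCells-All r x = Allₚ.map⁺ (Allₚ.applyUpTo⁺₁ (λ j → j) x λ j<x → refl , j<x)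

cellsFrom-All : ∀ r μ → All (λ b → r ≤ proj₁ b) (cellsFrom r μ)
cellsFrom-All r [] = []
cellsFrom-All r (x ∷ μ) = Allₚ.++⁺
  (All.map (λ (e , _) → ≤-reflexive (sym e)) (rowCells-All r x))
  (All.map <⇒≤ (cellsFrom-All (suc r) μ))

-- The cell lies to the right of its own row of μ, so only the cells of μ in later rows follow it in
-- reading order.
∏-κ-cellsFrom : ∀ r μ i x → part μ i ≤ x → ∏ (cellsFrom r μ) (κ (i + r , x)) ≡ neg1^ (size (drop (suc i) μ))
∏-κ-cellsFrom r [] i x _ = refl
∏-κ-cellsFrom r (m ∷ μ) zero x m≤x = begin
  ∏ (rowCells r m ++ cellsFrom (suc r) μ) (κ (r , x))
    ≡⟨ ∏-++ (rowCells r m) _ _ ⟩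
  ∏ (rowCells r m) (κ (r , x)) *ℤ ∏ (cellsFrom (suc r) μ) (κ (r , x))
    ≡⟨ cong₂ _*ℤ_ (∏-one (All.map (λ { (refl , q) → κ-left {r} (≤-trans (<⇒≤ q) m≤x) }) (rowCells-All r m)))
                  (∏-minus (All.map (λ {b} → κ-below {r , x} {b}) (cellsFrom-All (suc r) μ))) ⟩
  1ℤ *ℤ neg1^ (length (cellsFrom (suc r) μ))
    ≡⟨ trans (*-identityˡ _) (cong neg1^ (length-cellsFrom (suc r) μ)) ⟩
  neg1^ (size μ) ∎
∏-κ-cellsFrom r (m ∷ μ) (suc i) x q = begin
  ∏ (rowCells r m ++ cellsFrom (suc r) μ) (κ (suc i + r , x))
    ≡⟨ ∏-++ (rowCells r m) _ _ ⟩
  ∏ (rowCells r m) (κ (suc i + r , x)) *ℤ ∏ (cellsFrom (suc r) μ) (κ (suc i + r , x))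
    ≡⟨ cong₂ _*ℤ_ (∏-one (All.map (λ { {b} (refl , _) → κ-above {suc i + r , x} {b} (s≤s (m≤n+m r i)) }) (rowCells-All r m)))
                  (cong (λ k → ∏ (cellsFrom (suc r) μ) (κ (k , x))) (sym (+-suc i r))) ⟩
  1ℤ *ℤ ∏ (cellsFrom (suc r) μ) (κ (i + suc r , x))
    ≡⟨ trans (*-identityˡ _) (∏-κ-cellsFrom (suc r) μ i x q) ⟩
  neg1^ (size (drop (suc i) μ)) ∎

contained-trim : ∀ μ x xs → Part μ → Part xs → hd xs ≤ x →
                 containedᵇ μ (trim x xs) ≡ (hd μ ≤ᵇ x) ∧ containedᵇ (tl μ) xs
contained-trim [] zero [] _ _ _ = refl
contained-trim (suc m ∷ μ) zero [] _ _ _ = refl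
contained-trim μ zero (y ∷ xs) _ (1≤y , _) y≤0 = ⊥-elim (<⇒≱ 1≤y y≤0)
contained-trim μ (suc x) xs _ _ _ = containedᵇ-∷ μ (suc x) xs

skewFrom-trim : ∀ r μ x xs → Part xs → hd xs ≤ x →
                skewFrom r (trim x xs) μ ≡ seg r (hd μ) x ++ skewFrom (suc r) xs (tl μ)
skewFrom-trim r μ zero [] _ _ = refl
skewFrom-trim r μ zero (y ∷ xs) (1≤y , _) y≤0 = ⊥-elim (<⇒≱ 1≤y y≤0)
skewFrom-trim r μ (suc x) xs _ _ = refl

-- Only the last cell of a row can be maximal, and it is so exactly when the next row is shorter.
∑picks-skewFrom : ∀ r pre ν μ (χ : Cell → ℤ) (g : List Cell → ℤ) → Part ν → Part μ → T (containedᵇ μ ν) →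
  All (λ b → proj₁ b < r) pre →
  (∀ i x → part μ i ≤ x → χ (i + r , x) ≡ neg1^ (size (drop (suc i) μ))) →
  ∑picks (skewFrom r ν μ) (λ c ds → ∏ (pre ++ ds) (ρ c) *ℤ χ c *ℤ g (pre ++ ds))
  ≡ U (λ η → ⟦ containedᵇ μ η ⟧ *ℤ g (pre ++ skewFrom r η μ)) ν
∑picks-skewFrom r pre [] μ χ g _ _ _ _ _ = refl
∑picks-skewFrom r pre (suc x ∷ xs) μ χ g (_ , h≤ , P) Q q above Hχ =
  trans (∑picks-++ row rest F) (cong₂ _+ℤ_ first second)
  where
  a = hd μ
  a≤ = proj₁ (contained-split μ (suc x) xs q)
  q′ = proj₂ (contained-split μ (suc x) xs q)
  row = seg r a (suc x)
  rest = skewFrom (suc r) xs (tl μ)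
  c : Cell
  c = r , x
  F : Cell → List Cell → ℤ
  F d ds = ∏ (pre ++ ds) (ρ d) *ℤ χ d *ℤ g (pre ++ ds)

  second : ∑picks rest (λ d ds → F d (row ++ ds))
         ≡ U (λ η → ⟦ containedᵇ μ (suc x ∷ η) ⟧ *ℤ g (pre ++ skewFrom r (suc x ∷ η) μ)) xs
  second = begin
    ∑picks rest (λ d ds → F d (row ++ ds))
      ≡⟨ ∑picks-cong rest (λ d ds _ → cong (λ l → ∏ l (ρ d) *ℤ χ d *ℤ g l) (sym (++-assoc pre row ds))) ⟩
    ∑picks rest (λ d ds → ∏ ((pre ++ row) ++ ds) (ρ d) *ℤ χ d *ℤ g ((pre ++ row) ++ ds))
      -- The row just passed joins `pre`, so that `ρ` and `g` still see every remaining cell of the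
      -- shape.
      ≡⟨ ∑picks-skewFrom (suc r) (pre ++ row) xs (tl μ) χ g P (proj₂ (hd-tl μ Q)) q′
           (Allₚ.++⁺ (All.map m≤n⇒m≤1+n above) (All.map (λ (e , _) → s≤s (≤-reflexive e)) (seg-All r a (suc x))))
           (λ i y le → trans (cong (λ k → χ (k , y)) (+-suc i r))
             (trans (Hχ (suc i) y (subst (_≤ y) (sym (part-suc μ i)) le)) (cong (neg1^ ∘ size) (drop-tl μ i)))) ⟩
    U (λ η → ⟦ containedᵇ (tl μ) η ⟧ *ℤ g ((pre ++ row) ++ skewFrom (suc r) η (tl μ))) xs
      ≡⟨ U-cong xs P (λ η _ → cong₂ (λ b l → ⟦ b ⟧ *ℤ g l)
           (sym (trans (containedᵇ-∷ μ (suc x) η) (cong (_∧ containedᵇ (tl μ) η) (T-true (≤⇒≤ᵇ a≤)))))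
           (++-assoc pre row _)) ⟩
    U (λ η → ⟦ containedᵇ μ (suc x ∷ η) ⟧ *ℤ g (pre ++ skewFrom r (suc x ∷ η) μ)) xs ∎
    where
    drop-tl : ∀ μ i → drop (suc (suc i)) μ ≡ drop (suc i) (tl μ)
    drop-tl [] i = refl
    drop-tl (_ ∷ _) i = refl

  removal : ℤ
  removal = ⟦ hd xs <ᵇ suc x ⟧ *ℤ (s xs *ℤ (⟦ containedᵇ μ (trim x xs) ⟧ *ℤ g (pre ++ skewFrom r (trim x xs) μ)))

  -- Here the whole row belongs to μ: there is no cell to pick, and the shortened shape would no
  -- longer contain μ.
  unremovable : ¬ a ≤ x → removal ≡ 0ℤ
  unremovable a≰x = trans
    (⟦⟧-cong (hd xs <ᵇ suc x) λ t → trans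
      (cong (λ b → s xs *ℤ (⟦ b ⟧ *ℤ g (pre ++ skewFrom r (trim x xs) μ)))
        (trans (contained-trim μ x xs Q P (≤-pred (<ᵇ⇒< (hd xs) (suc x) t)))
               (cong (_∧ containedᵇ (tl μ) xs) (≤ᵇ-false (≰⇒> a≰x)))))
      (*-zeroʳ (s xs)))
    (*-zeroʳ ⟦ hd xs <ᵇ suc x ⟧)

  corner : a ≤ x → F c (seg r a x ++ rest) ≡ removal
  corner a≤x with hd xs ≤? x
  ... | yes h≤x = begin
    ∏ (pre ++ (seg r a x ++ rest)) (ρ c) *ℤ χ c *ℤ G′
      ≡⟨ cong (λ z → z *ℤ χ c *ℤ G′) (trans (∏-++ pre _ _) (cong (∏ pre (ρ c) *ℤ_) (∏-++ (seg r a x) _ _))) ⟩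
    ∏ pre (ρ c) *ℤ (∏ (seg r a x) (ρ c) *ℤ ∏ rest (ρ c)) *ℤ χ c *ℤ G′
      ≡⟨ cong₂ (λ y z → y *ℤ (z *ℤ ∏ rest (ρ c)) *ℤ χ c *ℤ G′)
           (∏-one (All.map (λ {b} → ρ-above {c} {b}) above))
           (∏-one (All.map (λ { (refl , lt) → ρ-left {r} lt }) (seg-All r a x))) ⟩
    1ℤ *ℤ (1ℤ *ℤ ∏ rest (ρ c)) *ℤ χ c *ℤ G′
      ≡⟨ cong₂ (λ y z → 1ℤ *ℤ (1ℤ *ℤ y) *ℤ z *ℤ G′)
           (∏-minus (All.map (λ {b} (lt , lt′) → ρ-below {c} {b} lt (≤-trans lt′ h≤x)) (skewFrom-All (suc r) xs (tl μ) P)))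
           (Hχ 0 x (subst (_≤ x) (sym (part-0 μ)) a≤x)) ⟩
    1ℤ *ℤ (1ℤ *ℤ neg1^ (length rest)) *ℤ neg1^ (size (tl μ)) *ℤ G′
      ≡⟨ lem (neg1^ (length rest)) (neg1^ (size (tl μ))) G′ ⟩
    1ℤ *ℤ (neg1^ (length rest) *ℤ neg1^ (size (tl μ)) *ℤ (1ℤ *ℤ G′))
      -- The cells below the row that lie in the skew shape and those that lie in μ together make up
      -- all of `xs`, which yields the sign `s xs` of `U`.
      ≡⟨ cong (λ z → 1ℤ *ℤ (z *ℤ (1ℤ *ℤ G′)))
           (trans (sym (neg1^-+ (length rest) (size (tl μ)))) (cong neg1^ (length-skewFrom (suc r) xs (tl μ) q′))) ⟩
    1ℤ *ℤ (s xs *ℤ (1ℤ *ℤ G′))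
      ≡⟨ cong₂ (λ y z → y *ℤ (s xs *ℤ (z *ℤ G′))) (⟦⟧-true (<⇒<ᵇ (s≤s h≤x)))
           (trans (cong ⟦_⟧ (contained-trim μ x xs Q P h≤x)) (⟦⟧-true (∧-intro (≤⇒≤ᵇ a≤x) q′))) ⟨
    ⟦ hd xs <ᵇ suc x ⟧ *ℤ (s xs *ℤ (⟦ containedᵇ μ (trim x xs) ⟧ *ℤ G′))
      ≡⟨ cong (λ l → ⟦ hd xs <ᵇ suc x ⟧ *ℤ (s xs *ℤ (⟦ containedᵇ μ (trim x xs) ⟧ *ℤ g (pre ++ l))))
           (skewFrom-trim r μ x xs P h≤x) ⟨
    removal ∎
    where
    G′ = g (pre ++ (seg r a x ++ rest))
    lem : ∀ a b c → 1ℤ *ℤ (1ℤ *ℤ a) *ℤ b *ℤ c ≡ 1ℤ *ℤ (a *ℤ b *ℤ (1ℤ *ℤ c))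
    lem = solve-∀
  ... | no h≰x = trans (cong (λ z → z *ℤ χ c *ℤ g (pre ++ (seg r a x ++ rest))) blocked)
                       (sym (cong (λ b → ⟦ b ⟧ *ℤ (s xs *ℤ (⟦ containedᵇ μ (trim x xs) ⟧ *ℤ g (pre ++ skewFrom r (trim x xs) μ))))
                              (<ᵇ-false (≰⇒> h≰x))))
    where
    -- If the next row reaches column x, its last cell lies weakly to the right of c, and outside μ
    -- because the rows of μ decrease. That cell rules out the largest entry at c.
    nextRow : ∀ xs → ¬ hd xs ≤ x → ∏ (skewFrom (suc r) xs (tl μ)) (ρ c) ≡ 0ℤ
    nextRow [] n = ⊥-elim (n z≤n)
    nextRow (zero ∷ xs) n = ⊥-elim (n z≤n)
    nextRow (suc y ∷ xs) n = trans
      (cong (λ l → ∏ l (ρ c)) (trans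
        (cong (_++ skewFrom (suc (suc r)) xs (tl (tl μ)))
          (seg-snoc (suc r) (hd (tl μ)) y (≤-trans (proj₁ (hd-tl μ Q)) (≤-trans a≤x x≤y))))
        (++-assoc (seg (suc r) (hd (tl μ)) y) _ _)))
      (∏-zero (ρ c) (seg (suc r) (hd (tl μ)) y) (suc r , y) _ (ρ-dominated {c} {suc r , y} (n≤1+n r) x≤y))
      where
      x≤y : x ≤ y
      x≤y = ≤-pred (≰⇒> n)
    blocked : ∏ (pre ++ (seg r a x ++ rest)) (ρ c) ≡ 0ℤ
    blocked = trans (∏-++ pre _ _) (trans (cong (∏ pre (ρ c) *ℤ_) (trans (∏-++ (seg r a x) rest _)
      (trans (cong (∏ (seg r a x) (ρ c) *ℤ_) (nextRow xs h≰x)) (*-zeroʳ (∏ (seg r a x) (ρ c)))))) (*-zeroʳ (∏ pre (ρ c))))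

  first : ∑picks row (λ d ds → F d (ds ++ rest)) ≡ removal
  first with a ≤? x
  ... | no a≰x = trans (cong (λ l → ∑picks l (λ d ds → F d (ds ++ rest))) (seg-empty r a (suc x) (≰⇒> a≰x)))
                       (sym (unremovable a≰x))
  ... | yes a≤x = begin
    ∑picks row (λ d ds → F d (ds ++ rest))
      ≡⟨ cong (λ l → ∑picks l (λ d ds → F d (ds ++ rest))) (seg-snoc r a x a≤x) ⟩
    ∑picks (seg r a x ++ [ c ]) (λ d ds → F d (ds ++ rest))
      ≡⟨ ∑picks-++ (seg r a x) [ c ] _ ⟩
    ∑picks (seg r a x) (λ d ds → F d ((ds ++ [ c ]) ++ rest)) +ℤ (F c ((seg r a x ++ []) ++ rest) +ℤ 0ℤ)
      ≡⟨ cong₂ (λ y z → y +ℤ (F c z +ℤ 0ℤ)) (∑picks-zero (seg r a x) dominated)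
           (cong (_++ rest) (++-identityʳ (seg r a x))) ⟩
    0ℤ +ℤ (F c (seg r a x ++ rest) +ℤ 0ℤ)
      ≡⟨ lem (F c (seg r a x ++ rest)) ⟩
    F c (seg r a x ++ rest)
      ≡⟨ corner a≤x ⟩
    removal ∎
    where
    lem : ∀ z → 0ℤ +ℤ (z +ℤ 0ℤ) ≡ z
    lem = solve-∀
    dominated : ∀ d ds → seg r a x ↭ (d ∷ ds) → F d ((ds ++ [ c ]) ++ rest) ≡ 0ℤ
    dominated d ds p with All.head (All-resp-↭ p (seg-All r a x))
    ... | refl , lt = cong (λ z → z *ℤ χ d *ℤ g (pre ++ ((ds ++ [ c ]) ++ rest)))
      (trans (cong (λ l → ∏ l (ρ d)) (trans (cong (pre ++_) (++-assoc ds [ c ] rest)) (sym (++-assoc pre ds _))))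
             (∏-zero (ρ d) (pre ++ ds) c rest (ρ-dominated {d} {c} ≤-refl (<⇒≤ lt))))

-- I extended by zero to pairs that are not a skew shape with m cells.
K : ℕ → List ℕ → List ℕ → ℤ
K m ν α = ⟦ skewSizeᵇ ν α m ⟧ *ℤ I ν α

containedᵇ-trans : ∀ xs ys zs → T (containedᵇ xs ys) → T (containedᵇ ys zs) → T (containedᵇ xs zs)
containedᵇ-trans [] ys zs _ _ = tt
containedᵇ-trans (x ∷ xs) (y ∷ ys) (z ∷ zs) p q with ∧-elim {x ≤ᵇ y} p | ∧-elim {y ≤ᵇ z} q
... | a , b | a′ , b′ = ∧-intro (≤⇒≤ᵇ (≤-trans (≤ᵇ⇒≤ x y a) (≤ᵇ⇒≤ y z a′))) (containedᵇ-trans xs ys zs b b′)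

contained-size : ∀ xs ys → T (containedᵇ xs ys) → size xs ≤ size ys
contained-size [] ys _ = z≤n
contained-size (x ∷ xs) (y ∷ ys) q with ∧-elim {x ≤ᵇ y} q
... | a , b = +-mono-≤ (≤ᵇ⇒≤ x y a) (contained-size xs ys b)

contained-≡ : ∀ xs ys → Part ys → T (containedᵇ xs ys) → size ys ≡ size xs → T (eqᵇ xs ys)
contained-≡ [] [] _ _ _ = tt
contained-≡ [] (suc y ∷ ys) _ _ ()
contained-≡ (x ∷ xs) (y ∷ ys) (_ , _ , P) q e with ∧-elim {x ≤ᵇ y} q
... | a , b with ≤-antisym (≤ᵇ⇒≤ x y a) 
       (≮⇒≥ λ x<y → <⇒≢ (+-mono-<-≤ x<y (contained-size xs ys b)) (sym e))
... | refl = ∧-intro (≡⇒≡ᵇ x x refl) (contained-≡ xs ys P b (+-cancelˡ-≡ x _ _ e))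

I-self : ∀ α → I α α ≡ 1ℤ
I-self α = trans (I-G α α) (cong (G α) (trans (skewCells-skewFrom α α) (empty _ len)))
  where
  empty : ∀ (l : List Cell) → length l ≡ 0 → l ≡ []
  empty [] _ = refl
  len : length (skewFrom 0 α α) ≡ 0
  len = +-cancelʳ-≡ (size α) _ 0 (length-skewFrom 0 α α (containedᵇ-refl α))

I-step : ∀ ν α m → Part ν → Part α → T (containedᵇ α ν) → size ν ≡ size α + suc m →
         I ν α ≡ U (λ η → ⟦ containedᵇ α η ⟧ *ℤ I η α) ν
I-step ν α m P Q q e = begin
  I ν α
    ≡⟨ trans (I-G ν α) (cong (G α) (skewCells-skewFrom ν α)) ⟩
  G α (skewFrom 0 ν α)
    ≡⟨ G-step α (skewFrom 0 ν α) m (+-cancelʳ-≡ (size α) _ (suc m)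
         (trans (length-skewFrom 0 ν α q) (trans e (+-comm (size α) (suc m))))) ⟩
  ∑picks (skewFrom 0 ν α) (λ c ds → ∏ ds (ρ c) *ℤ crossing α c *ℤ G α ds)
    ≡⟨ ∑picks-skewFrom 0 [] ν α (crossing α) (G α) P Q q [] (∏-κ-cellsFrom 0 α) ⟩
  U (λ η → ⟦ containedᵇ α η ⟧ *ℤ G α (skewFrom 0 η α)) ν
    ≡⟨ U-cong ν P (λ η _ → cong (⟦ containedᵇ α η ⟧ *ℤ_)
         (trans (I-G η α) (cong (G α) (skewCells-skewFrom η α)))) ⟨
  U (λ η → ⟦ containedᵇ α η ⟧ *ℤ I η α) ν ∎

-- The work is in the guard of `K`. If it holds at ν, every η covered by ν has the right size, so
-- only containment is left to test. If it fails at ν, it fails at all such η, and both sides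
-- vanish.
K-U^ : ∀ m ν α → Part ν → Part α → K m ν α ≡ U^ m (δ α) ν
K-U^ zero ν α P Q with eqᵇ α ν in eq
... | true with eqᵇ-≡ α ν (subst T (sym eq) tt)
...   | refl = cong₂ _*ℤ_ (⟦⟧-true (∧-intro {containedᵇ α α} (containedᵇ-refl α)
                 (≡⇒≡ᵇ (size α) (size α + 0) (sym (+-identityʳ (size α)))))) (I-self α)
K-U^ zero ν α P Q | false = cong (λ b → ⟦ b ⟧ *ℤ I ν α) (¬T-false λ t →
  let (a , b) = ∧-elim {containedᵇ α ν} t in
  subst T eq (contained-≡ α ν P a (trans (≡ᵇ⇒≡ (size ν) _ b) (+-identityʳ (size α)))))
K-U^ (suc m) ν α P Q = trans peel (U-cong ν P λ η (R , _) → K-U^ m η α R Q)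
  where
  peel : K (suc m) ν α ≡ U (λ η → K m η α) ν
  peel with skewSizeᵇ ν α (suc m) in eq
  ... | true = begin
    1ℤ *ℤ I ν α
      ≡⟨ *-identityˡ _ ⟩
    I ν α
      ≡⟨ I-step ν α m P Q (proj₁ both) size≡ ⟩
    U (λ η → ⟦ containedᵇ α η ⟧ *ℤ I η α) ν
      ≡⟨ U-cong ν P (λ η (_ , e , _) → cong (λ b → ⟦ b ⟧ *ℤ I η α)
           (trans (sym (∧-identityʳ (containedᵇ α η)))
             (cong (containedᵇ α η ∧_) (sym (T-true (≡⇒≡ᵇ (size η) (size α + m)
               (suc-injective (trans e (trans size≡ (+-suc (size α) m)))))))))) ⟩
    U (λ η → K m η α) ν ∎
    where
    both = ∧-elim {containedᵇ α ν} (subst T (sym eq) tt)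
    size≡ = ≡ᵇ⇒≡ (size ν) (size α + suc m) (proj₂ both)
  ... | false = sym (trans (U-cong ν P λ η (_ , e , c) → cong (λ b → ⟦ b ⟧ *ℤ I η α) (¬T-false λ t →
    let (a , b) = ∧-elim {containedᵇ α η} t in
    subst T eq (∧-intro (containedᵇ-trans α η ν a c)
      (≡⇒≡ᵇ (size ν) _ (trans (sym e) (trans (cong suc (≡ᵇ⇒≡ (size η) _ b)) (sym (+-suc (size α) m)))))))) (U-0 ν))

-- Matrix coefficients

IsPartition⇒Part : ∀ xs → IsPartition xs → Part xs
IsPartition⇒Part [] _ = tt
IsPartition⇒Part (x ∷ []) (p ∷ [] , _) = p , z≤n , tt
IsPartition⇒Part (x ∷ y ∷ ys) (p ∷ ps , q ∷ qs) = p , q , IsPartition⇒Part (y ∷ ys) (ps , qs)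

isPartitionᵇ⇒Part : ∀ xs → T (isPartitionᵇ xs) → Part xs
isPartitionᵇ⇒Part xs t = build xs (proj₁ (∧-elim t)) (proj₂ (∧-elim {positiveᵇ xs} t))
  where
  build : ∀ xs → T (positiveᵇ xs) → T (decreasingᵇ xs) → Part xs
  build [] _ _ = tt
  build (x ∷ []) p _ = ≤ᵇ⇒≤ 1 x (proj₁ (∧-elim p)) , z≤n , tt
  build (x ∷ y ∷ ys) p d = let (a , b) = ∧-elim {1 ≤ᵇ x} p ; (a′ , b′) = ∧-elim {y ≤ᵇ x} d in
    ≤ᵇ⇒≤ 1 x a , ≤ᵇ⇒≤ y x a′ , build (y ∷ ys) b b′

Part⇒isPartitionᵇ : ∀ xs → Part xs → T (isPartitionᵇ xs)
Part⇒isPartitionᵇ xs P = ∧-intro {positiveᵇ xs} (pos xs P) (dec xs P)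
  where
  pos : ∀ xs → Part xs → T (positiveᵇ xs)
  pos [] _ = tt
  pos (x ∷ xs) (p , _ , P) = ∧-intro {1 ≤ᵇ x} (≤⇒≤ᵇ p) (pos xs P)
  dec : ∀ xs → Part xs → T (decreasingᵇ xs)
  dec [] _ = tt
  dec (x ∷ []) _ = tt
  dec (x ∷ y ∷ ys) (_ , q , P) = ∧-intro {y ≤ᵇ x} (≤⇒≤ᵇ q) (dec (y ∷ ys) P)

-- Sums over the enumerated partitions

∑-zero : ∀ {X : Set} (xs : List X) {f} → (∀ x → f x ≡ 0ℤ) → ∑ xs f ≡ 0ℤ
∑-zero xs e = trans (∑-ext {g = λ _ → 0ℤ *ℤ 0ℤ} xs e) (∑-* 0ℤ xs (const 0ℤ))

∑-upTo-suc : ∀ n (f : ℕ → ℤ) → ∑ (upTo (suc n)) f ≡ f 0 +ℤ ∑ (upTo n) (f ∘ suc)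
∑-upTo-suc n f = cong (f 0 +ℤ_) (trans (cong (λ l → ∑ l f) (sym (map-upTo suc n))) (∑-map suc (upTo n) f))

∑-upTo-select : ∀ n y (f : ℕ → ℤ) → ∑ (upTo n) (λ x → ⟦ x ≡ᵇ y ⟧ *ℤ f x) ≡ ⟦ y <ᵇ n ⟧ *ℤ f y
∑-upTo-select zero y f = refl
∑-upTo-select (suc n) zero f = trans (∑-upTo-suc n (λ x → ⟦ x ≡ᵇ 0 ⟧ *ℤ f x))
  (trans (cong (1ℤ *ℤ f 0 +ℤ_) (∑-zero (upTo n) λ _ → refl)) (+ℤ-identityʳ _))
∑-upTo-select (suc n) (suc y) f = trans (∑-upTo-suc n (λ x → ⟦ x ≡ᵇ suc y ⟧ *ℤ f x))
  (trans (cong (0ℤ +ℤ_) (∑-upTo-select n y (f ∘ suc))) (+ℤ-identityˡ _))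

∑-listsOfLength : ∀ k N η (f : Shapes) → All (λ x → 1 ≤ x × x ≤ N) η →
  ∑ (listsOfLength k N) (λ l → ⟦ eqᵇ l η ⟧ *ℤ f l) ≡ ⟦ k ≡ᵇ length η ⟧ *ℤ f η
∑-listsOfLength zero N [] f _ = +ℤ-identityʳ _
∑-listsOfLength zero N (y ∷ η) f _ = refl
∑-listsOfLength (suc k) N [] f _ = trans (∑-concatMap _ (oneTo N) _)
  (∑-zero (oneTo N) λ x → trans (∑-map (x ∷_) (listsOfLength k N) _) (∑-zero (listsOfLength k N) λ _ → refl))
∑-listsOfLength (suc k) N (suc y ∷ η) f ((_ , y<N) ∷ bounds) = begin
  ∑ (concatMap (λ x → map (x ∷_) (listsOfLength k N)) (oneTo N)) (λ l → ⟦ eqᵇ l (suc y ∷ η) ⟧ *ℤ f l)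
    ≡⟨ ∑-concatMap _ (oneTo N) _ ⟩
  ∑ (oneTo N) (λ x → ∑ (map (x ∷_) (listsOfLength k N)) (λ l → ⟦ eqᵇ l (suc y ∷ η) ⟧ *ℤ f l))
    ≡⟨ ∑-ext (oneTo N) tails ⟩
  ∑ (oneTo N) (λ x → ⟦ x ≡ᵇ suc y ⟧ *ℤ (⟦ k ≡ᵇ length η ⟧ *ℤ f (x ∷ η)))
    ≡⟨ ∑-map suc (upTo N) _ ⟩
  ∑ (upTo N) (λ x → ⟦ x ≡ᵇ y ⟧ *ℤ (⟦ k ≡ᵇ length η ⟧ *ℤ f (suc x ∷ η)))
    ≡⟨ ∑-upTo-select N y _ ⟩
  ⟦ y <ᵇ N ⟧ *ℤ (⟦ k ≡ᵇ length η ⟧ *ℤ f (suc y ∷ η))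
    ≡⟨ trans (cong (_*ℤ (⟦ k ≡ᵇ length η ⟧ *ℤ f (suc y ∷ η))) (⟦⟧-true (<⇒<ᵇ y<N))) (*-identityˡ _) ⟩
  ⟦ k ≡ᵇ length η ⟧ *ℤ f (suc y ∷ η) ∎
  where
  tails : ∀ x → ∑ (map (x ∷_) (listsOfLength k N)) (λ l → ⟦ eqᵇ l (suc y ∷ η) ⟧ *ℤ f l)
        ≡ ⟦ x ≡ᵇ suc y ⟧ *ℤ (⟦ k ≡ᵇ length η ⟧ *ℤ f (x ∷ η))
  tails x = begin
    ∑ (map (x ∷_) (listsOfLength k N)) (λ l → ⟦ eqᵇ l (suc y ∷ η) ⟧ *ℤ f l)
      ≡⟨ ∑-map (x ∷_) (listsOfLength k N) _ ⟩
    ∑ (listsOfLength k N) (λ l → ⟦ (x ≡ᵇ suc y) ∧ eqᵇ l η ⟧ *ℤ f (x ∷ l))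
      ≡⟨ ∑-ext (listsOfLength k N) (λ l → trans (cong (_*ℤ f (x ∷ l)) (⟦⟧-∧ (x ≡ᵇ suc y) (eqᵇ l η)))
           (*-assoc ⟦ x ≡ᵇ suc y ⟧ ⟦ eqᵇ l η ⟧ (f (x ∷ l)))) ⟩
    ∑ (listsOfLength k N) (λ l → ⟦ x ≡ᵇ suc y ⟧ *ℤ (⟦ eqᵇ l η ⟧ *ℤ f (x ∷ l)))
      ≡⟨ ∑-* ⟦ x ≡ᵇ suc y ⟧ (listsOfLength k N) _ ⟩
    ⟦ x ≡ᵇ suc y ⟧ *ℤ ∑ (listsOfLength k N) (λ l → ⟦ eqᵇ l η ⟧ *ℤ f (x ∷ l))
      ≡⟨ cong (⟦ x ≡ᵇ suc y ⟧ *ℤ_) (∑-listsOfLength k N η (f ∘ (x ∷_)) bounds) ⟩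
    ⟦ x ≡ᵇ suc y ⟧ *ℤ (⟦ k ≡ᵇ length η ⟧ *ℤ f (x ∷ η)) ∎

Part-bounds : ∀ N xs → Part xs → size xs ≤ N → All (λ x → 1 ≤ x × x ≤ N) xs × length xs ≤ N
Part-bounds N [] _ _ = [] , z≤n
Part-bounds N xs@(_ ∷ _) P le = All.map (λ (p , q) → p , ≤-trans q le) (entries xs P) , ≤-trans (len xs P) le
  where
  entries : ∀ xs → Part xs → All (λ x → 1 ≤ x × x ≤ size xs) xs
  entries [] _ = []
  entries (x ∷ xs) (p , _ , P) = (p , m≤m+n x (size xs)) ∷
    All.map (λ (a , b) → a , ≤-trans b (m≤n+m (size xs) x)) (entries xs P)
  len : ∀ xs → Part xs → length xs ≤ size xs
  len [] _ = z≤n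
  len (x ∷ xs) (p , _ , P) = +-mono-≤ p (len xs P)

-- Every partition of size at most N occurs in the enumeration exactly once. Thus `f`, cut off at
-- size N, is a combination of the `δ l`, and a sum over intermediate shapes becomes a composition
-- of operators.
∑-partitionsUpTo : ∀ N η (f : Shapes) → Part η → ∑ (partitionsUpTo N) (λ l → f l *ℤ δ l η) ≡ ⟦ size η ≤ᵇ N ⟧ *ℤ f η
∑-partitionsUpTo N η f P = begin
  ∑ (partitionsUpTo N) (λ l → f l *ℤ δ l η)
    ≡⟨ ∑-filter small lists (λ l → f l *ℤ δ l η) ⟩
  ∑ lists (λ l → ⟦ small l ⟧ *ℤ (f l *ℤ δ l η))
    ≡⟨ ∑-ext lists (λ l → trans (lem ⟦ small l ⟧ (f l) ⟦ eqᵇ l η ⟧)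
         (⟦⟧-cong (eqᵇ l η) λ t → cong (λ z → ⟦ small z ⟧ *ℤ f l) (eqᵇ-≡ l η t))) ⟩
  ∑ lists (λ l → ⟦ eqᵇ l η ⟧ *ℤ (⟦ small η ⟧ *ℤ f l))
    ≡⟨ ∑-ext lists (λ l → exchange ⟦ eqᵇ l η ⟧ ⟦ small η ⟧ (f l)) ⟩
  ∑ lists (λ l → ⟦ small η ⟧ *ℤ (⟦ eqᵇ l η ⟧ *ℤ f l))
    ≡⟨ ∑-* ⟦ small η ⟧ lists _ ⟩
  ⟦ small η ⟧ *ℤ ∑ lists (λ l → ⟦ eqᵇ l η ⟧ *ℤ f l)
    ≡⟨ ⟦⟧-cong (small η) (λ t → select (≤ᵇ⇒≤ (size η) N (proj₂ (∧-elim {isPartitionᵇ η} t)))) ⟩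
  ⟦ small η ⟧ *ℤ f η
    ≡⟨ cong (λ b → ⟦ b ∧ (size η ≤ᵇ N) ⟧ *ℤ f η) (T-true (Part⇒isPartitionᵇ η P)) ⟩
  ⟦ size η ≤ᵇ N ⟧ *ℤ f η ∎
  where
  small : List ℕ → Bool
  small l = isPartitionᵇ l ∧ (size l ≤ᵇ N)
  lists = concatMap (λ k → listsOfLength k N) (upTo (suc N))
  lem : ∀ a b c → a *ℤ (b *ℤ c) ≡ c *ℤ (a *ℤ b)
  lem = solve-∀
  exchange : ∀ a b c → a *ℤ (b *ℤ c) ≡ b *ℤ (a *ℤ c)
  exchange = solve-∀
  select : size η ≤ N → ∑ lists (λ l → ⟦ eqᵇ l η ⟧ *ℤ f l) ≡ f η
  select le = let (bounds , len) = Part-bounds N η P le in begin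
    ∑ lists (λ l → ⟦ eqᵇ l η ⟧ *ℤ f l)
      ≡⟨ ∑-concatMap (λ k → listsOfLength k N) (upTo (suc N)) (λ l → ⟦ eqᵇ l η ⟧ *ℤ f l) ⟩
    ∑ (upTo (suc N)) (λ k → ∑ (listsOfLength k N) (λ l → ⟦ eqᵇ l η ⟧ *ℤ f l))
      ≡⟨ ∑-ext (upTo (suc N)) (λ k → ∑-listsOfLength k N η f bounds) ⟩
    ∑ (upTo (suc N)) (λ k → ⟦ k ≡ᵇ length η ⟧ *ℤ f η)
      ≡⟨ ∑-upTo-select (suc N) (length η) (const (f η)) ⟩
    ⟦ length η <ᵇ suc N ⟧ *ℤ f η
      ≡⟨ trans (cong (_*ℤ f η) (⟦⟧-true (<⇒<ᵇ (s≤s len)))) (*-identityˡ (f η)) ⟩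
    f η ∎

partitionsUpTo-Part : ∀ N → All Part (partitionsUpTo N)
partitionsUpTo-Part N = All.map (λ {l} t → isPartitionᵇ⇒Part l (proj₁ (∧-elim t))) (Allₚ.all-filter (λ l → T? (isPartitionᵇ l ∧ (size l ≤ᵇ N)))
  (concatMap (λ k → listsOfLength k N) (upTo (suc N))))

module Linear (Φ : Shapes → Shapes)
              (Φ-+ : ∀ f g ν → Φ (λ κ → f κ +ℤ g κ) ν ≡ Φ f ν +ℤ Φ g ν)
              (Φ-* : ∀ c f ν → Φ (λ κ → c *ℤ f κ) ν ≡ c *ℤ Φ f ν)
              (Φ-resp : ∀ {f g} → f ≈ g → Φ f ≈ Φ g) where

  Φ-∑ : ∀ {X : Set} (xs : List X) (c : X → ℤ) (f : X → Shapes) ν →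
        Φ (λ κ → ∑ xs (λ x → c x *ℤ f x κ)) ν ≡ ∑ xs (λ x → c x *ℤ Φ (f x) ν)
  Φ-∑ [] c f ν = Φ-* 0ℤ (const 0ℤ) ν
  Φ-∑ (x ∷ xs) c f ν = trans (Φ-+ _ _ ν) (cong₂ _+ℤ_ (Φ-* (c x) (f x) ν) (Φ-∑ xs c f ν))

  Φ^-∑ : ∀ n {X : Set} (xs : List X) (c : X → ℤ) (f : X → Shapes) →
         fold (λ κ → ∑ xs (λ x → c x *ℤ f x κ)) Φ n ≈ λ κ → ∑ xs (λ x → c x *ℤ fold (f x) Φ n κ)
  Φ^-∑ zero xs c f ν P = refl
  Φ^-∑ (suc n) xs c f ν P = trans (Φ-resp (Φ^-∑ n xs c f) ν P) (Φ-∑ xs c (λ x → fold (f x) Φ n) ν)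

U^-∑ = Linear.Φ^-∑ U U-+ U-* U-resp
D^-∑ = Linear.Φ^-∑ D (add-+ -1ℤ (const true)) (add-* -1ℤ (const true)) D-resp

-- `U` never reads a larger shape. This justifies the cut-off at `size β` in `sumDown`, although
-- `D^ n (δ α)` may be nonzero on larger shapes.
U^-resp-≤ : ∀ N m {f g} → (∀ κ → Part κ → size κ ≤ N → f κ ≡ g κ) →
            ∀ κ → Part κ → size κ ≤ N → U^ m f κ ≡ U^ m g κ
U^-resp-≤ N zero e = e
U^-resp-≤ N (suc m) e ν P le = U-cong ν P λ κ (Q , s≡ , _) →
  U^-resp-≤ N m e κ Q (≤-trans (n≤1+n (size κ)) (≤-trans (≤-reflexive s≡) le))

K-product : ∀ ν α m ν′ β n c → ⟦ skewSizeᵇ ν α m ∧ skewSizeᵇ ν′ β n ⟧ *ℤ (c *ℤ I ν α *ℤ I ν′ β)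
                            ≡ c *ℤ (K m ν α *ℤ K n ν′ β)
K-product ν α m ν′ β n c = trans (cong (_*ℤ (c *ℤ I ν α *ℤ I ν′ β)) (⟦⟧-∧ (skewSizeᵇ ν α m) (skewSizeᵇ ν′ β n)))
  (lem ⟦ skewSizeᵇ ν α m ⟧ ⟦ skewSizeᵇ ν′ β n ⟧ c (I ν α) (I ν′ β))
  where
  lem : ∀ a b c i j → a *ℤ b *ℤ (c *ℤ i *ℤ j) ≡ c *ℤ (a *ℤ i *ℤ (b *ℤ j))
  lem = solve-∀

sumUp-D^U^ : ∀ α β m n → Part α → Part β → σ β *ℤ sumUp α β m n ≡ D^ n (U^ m (δ α)) β
sumUp-D^U^ α β m n P Q = begin
  σ β *ℤ sumUp α β m n
    ≡⟨ cong (σ β *ℤ_) (∑-filter (λ l → skewSizeᵇ l α m ∧ skewSizeᵇ l β n) 𝒫 _) ⟩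
  σ β *ℤ ∑ 𝒫 (λ l → ⟦ skewSizeᵇ l α m ∧ skewSizeᵇ l β n ⟧ *ℤ (σ l *ℤ I l α *ℤ I l β))
    ≡⟨ ∑-* (σ β) 𝒫 _ ⟨
  ∑ 𝒫 (λ l → σ β *ℤ (⟦ skewSizeᵇ l α m ∧ skewSizeᵇ l β n ⟧ *ℤ (σ l *ℤ I l α *ℤ I l β)))
    ≡⟨ ∑-cong (partitionsUpTo-Part N) term ⟩
  ∑ 𝒫 (λ l → U^ m (δ α) l *ℤ D^ n (δ l) β)
    ≡⟨ D^-∑ n 𝒫 (U^ m (δ α)) δ β Q ⟨
  D^ n (λ κ → ∑ 𝒫 (λ l → U^ m (δ α) l *ℤ δ l κ)) β
    ≡⟨ D^-resp n (λ κ R → trans (∑-partitionsUpTo N κ (U^ m (δ α)) R) (supported κ R)) β Q ⟩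
  D^ n (U^ m (δ α)) β ∎
  where
  N = size α + m
  𝒫 = partitionsUpTo N
  cancel : ∀ a b x y → a *ℤ (b *ℤ (x *ℤ (b *ℤ a *ℤ y))) ≡ a *ℤ a *ℤ (b *ℤ b) *ℤ (x *ℤ y)
  cancel = solve-∀
  term : ∀ l → Part l → σ β *ℤ (⟦ skewSizeᵇ l α m ∧ skewSizeᵇ l β n ⟧ *ℤ (σ l *ℤ I l α *ℤ I l β))
                      ≡ U^ m (δ α) l *ℤ D^ n (δ l) β
  term l R = begin
    σ β *ℤ (⟦ skewSizeᵇ l α m ∧ skewSizeᵇ l β n ⟧ *ℤ (σ l *ℤ I l α *ℤ I l β))
      ≡⟨ cong (σ β *ℤ_) (K-product l α m l β n (σ l)) ⟩
    σ β *ℤ (σ l *ℤ (K m l α *ℤ K n l β))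
      ≡⟨ cong₂ (λ a b → σ β *ℤ (σ l *ℤ (a *ℤ b))) (K-U^ m l α R P)
           (trans (K-U^ n l β R Q) (U^-D^-adjoint n l β R Q)) ⟩
    σ β *ℤ (σ l *ℤ (U^ m (δ α) l *ℤ (σ l *ℤ σ β *ℤ D^ n (δ l) β)))
      ≡⟨ cancel (σ β) (σ l) (U^ m (δ α) l) (D^ n (δ l) β) ⟩
    σ β *ℤ σ β *ℤ (σ l *ℤ σ l) *ℤ (U^ m (δ α) l *ℤ D^ n (δ l) β)
      ≡⟨ cong₂ (λ a b → a *ℤ b *ℤ (U^ m (δ α) l *ℤ D^ n (δ l) β)) (neg1^-square (v β)) (neg1^-square (v l)) ⟩
    1ℤ *ℤ (U^ m (δ α) l *ℤ D^ n (δ l) β)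
      ≡⟨ *-identityˡ _ ⟩
    U^ m (δ α) l *ℤ D^ n (δ l) β ∎
  -- `D` reads larger shapes, so here the cut-off is harmless for another reason: `U^ m (δ α)` lives
  -- on shapes of size exactly N.
  supported : ∀ κ → Part κ → ⟦ size κ ≤ᵇ N ⟧ *ℤ U^ m (δ α) κ ≡ U^ m (δ α) κ
  supported κ R with size κ ≤ᵇ N in eq
  ... | true = *-identityˡ _
  ... | false = sym (trans (sym (K-U^ m κ α R P)) (cong (λ b → ⟦ b ⟧ *ℤ I κ α) (¬T-false λ t →
    subst T eq (≤⇒≤ᵇ (≤-reflexive (≡ᵇ⇒≡ (size κ) N (proj₂ (∧-elim {containedᵇ α κ} t))))))))

sumDown-U^D^ : ∀ α β m n → Part α → Part β → sumDown α β m n ≡ σ α *ℤ U^ m (D^ n (δ α)) β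
sumDown-U^D^ α β m n P Q = begin
  sumDown α β m n
    ≡⟨ ∑-filter (λ l → skewSizeᵇ β l m ∧ skewSizeᵇ α l n) 𝒫 _ ⟩
  ∑ 𝒫 (λ l → ⟦ skewSizeᵇ β l m ∧ skewSizeᵇ α l n ⟧ *ℤ (σ l *ℤ I β l *ℤ I α l))
    ≡⟨ ∑-cong (partitionsUpTo-Part N) term ⟩
  ∑ 𝒫 (λ l → σ α *ℤ (D^ n (δ α) l *ℤ U^ m (δ l) β))
    ≡⟨ ∑-* (σ α) 𝒫 _ ⟩
  σ α *ℤ ∑ 𝒫 (λ l → D^ n (δ α) l *ℤ U^ m (δ l) β)
    ≡⟨ cong (σ α *ℤ_) (sym (U^-∑ m 𝒫 (D^ n (δ α)) δ β Q)) ⟩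
  σ α *ℤ U^ m (λ κ → ∑ 𝒫 (λ l → D^ n (δ α) l *ℤ δ l κ)) β
    ≡⟨ cong (σ α *ℤ_) (U^-resp-≤ N m (λ κ R le → trans (∑-partitionsUpTo N κ (D^ n (δ α)) R)
         (trans (cong (_*ℤ D^ n (δ α) κ) (⟦⟧-true (≤⇒≤ᵇ le))) (*-identityˡ _))) β Q ≤-refl) ⟩
  σ α *ℤ U^ m (D^ n (δ α)) β ∎
  where
  N = size β
  𝒫 = partitionsUpTo N
  cancel : ∀ a b x y → b *ℤ (x *ℤ (a *ℤ b *ℤ y)) ≡ b *ℤ b *ℤ (a *ℤ (y *ℤ x))
  cancel = solve-∀
  term : ∀ l → Part l → ⟦ skewSizeᵇ β l m ∧ skewSizeᵇ α l n ⟧ *ℤ (σ l *ℤ I β l *ℤ I α l)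
                      ≡ σ α *ℤ (D^ n (δ α) l *ℤ U^ m (δ l) β)
  term l R = begin
    ⟦ skewSizeᵇ β l m ∧ skewSizeᵇ α l n ⟧ *ℤ (σ l *ℤ I β l *ℤ I α l)
      ≡⟨ K-product β l m α l n (σ l) ⟩
    σ l *ℤ (K m β l *ℤ K n α l)
      ≡⟨ cong₂ (λ a b → σ l *ℤ (a *ℤ b)) (K-U^ m β l Q R) (trans (K-U^ n α l P R) (U^-D^-adjoint n α l P R)) ⟩
    σ l *ℤ (U^ m (δ l) β *ℤ (σ α *ℤ σ l *ℤ D^ n (δ α) l))
      ≡⟨ cancel (σ α) (σ l) (U^ m (δ l) β) (D^ n (δ α) l) ⟩
    σ l *ℤ σ l *ℤ (σ α *ℤ (D^ n (δ α) l *ℤ U^ m (δ l) β))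
      ≡⟨ cong (_*ℤ (σ α *ℤ (D^ n (δ α) l *ℤ U^ m (δ l) β))) (neg1^-square (v l)) ⟩
    1ℤ *ℤ (σ α *ℤ (D^ n (δ α) l *ℤ U^ m (δ l) β))
      ≡⟨ *-identityˡ _ ⟩
    σ α *ℤ (D^ n (δ α) l *ℤ U^ m (δ l) β) ∎

theorem5p8 : (α β : List ℕ) → IsPartition α → IsPartition β → (m n : ℕ) →
    neg1^ (v α + v β) *ℤ sumUp α β m n
    ≡ (neg1^ (m * n) *ℤ sumDown α β m n)
    +ℤ (((+ 1 - neg1^ (m * n)) / (+ 2)) *ℤ sumDown α β (m ∸ 1) (n ∸ 1))
theorem5p8 α β α-part β-part m n = begin
  neg1^ (v α + v β) *ℤ sumUp α β m n
    ≡⟨ trans (cong (_*ℤ sumUp α β m n) (neg1^-+ (v α) (v β))) (*-assoc (σ α) (σ β) _) ⟩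
  σ α *ℤ (σ β *ℤ sumUp α β m n)
    ≡⟨ cong (σ α *ℤ_) (trans (sumUp-D^U^ α β m n P Q) (D^-U^ m n (δ α) β Q)) ⟩
  σ α *ℤ (e *ℤ x +ℤ c *ℤ y)
    ≡⟨ distribute (σ α) e x c y ⟩
  e *ℤ (σ α *ℤ x) +ℤ c *ℤ (σ α *ℤ y)
    ≡⟨ cong₂ (λ a b → e *ℤ a +ℤ c *ℤ b) (sumDown-U^D^ α β m n P Q) (sumDown-U^D^ α β (m ∸ 1) (n ∸ 1) P Q) ⟨
  e *ℤ sumDown α β m n +ℤ c *ℤ sumDown α β (m ∸ 1) (n ∸ 1) ∎
  where
  P = IsPartition⇒Part α α-part
  Q = IsPartition⇒Part β β-part
  e = neg1^ (m * n)
  c = (+ 1 - neg1^ (m * n)) / (+ 2)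
  x = U^ m (D^ n (δ α)) β
  y = U^ (m ∸ 1) (D^ (n ∸ 1) (δ α)) β
  distribute : ∀ a e x c y → a *ℤ (e *ℤ x +ℤ c *ℤ y) ≡ e *ℤ (a *ℤ x) +ℤ c *ℤ (a *ℤ y)
  distribute = solve-∀
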